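{- There exists a left-computable real number $x$ which is nearly computable but not regainingly approximable.
   Context: A real number is left-computable if there is a computable non-decreasing sequence of rational numbers converging to it. A real $x$ is regainingly approximable if there is a computable non-decreasing sequence of rationals $(x_n)_n$ converging to $x$ with $x - x_n < 2^{ -n}$ for infinitely many $n\in\mathbb{N}$. A function $f:\mathbb{N}\to\mathbb{N}$ is a modulus of convergence of a convergent sequence $(y_n)_n$ with limit $y$ if for all $n$ and all $m\ge f(n)$ we have $|y-y_m|<2^{ -n}$; $(y_n)_n$ converges computably if it has a computable modulus of convergence. A sequence $(x_n)_n$ converges nearly computably if it converges and for every computable increasing function $s:\mathbb{N}\to\mathbb{N}$ the sequence $(x_{s(n+1)}-x_{s(n)})_n$ converges computably to $0$. A real is nearly computable if some computable sequence of rationals converges nearly computably to it. -}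

module Defs where

open import Data.Fin using (Fin)
open import Data.Integer as ℤ using (_⊖_; 1ℤ)
open import Data.Nat as ℕ using (ℕ; zero; suc)
open import Data.Nat.Properties using (m^n≢0)
open import Data.Product using (∃; _×_; _,_)
open import Data.Rational using (ℚ; 0ℚ; 1ℚ; _/_; _+_; _-_; -_; _<_; _≤_)
open import Data.Rational.Properties
open import Data.Sum using (_⊎_; inj₁; inj₂)
open import Data.Vec using (Vec; []; _∷_; lookup)
open import Data.Vec.Relation.Binary.Pointwise.Inductive using (Pointwise)
open import Function using (_⇔_; mk⇔)
open import Relation.Binary.Core using (_Preserves_⟶_)
open import Relation.Binary.Definitions using (tri<; tri≈; tri>)
open import Relation.Binary.PropositionalEquality using (_≡_; refl; subst)
open import Relation.Nullary using (¬_)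
open import Relation.Nullary.Decidable using (from-yes)

------------------------------------------------------------------------
-- Computability: Kleene's μ-recursive functions

data Rec : ℕ → Set where
  zer  : Rec 0
  succ : Rec 1
  proj : ∀ {n} → Fin n → Rec n
  comp : ∀ {m n} → Rec m → Vec (Rec n) m → Rec n
  prec : ∀ {n} → Rec n → Rec (2 ℕ.+ n) → Rec (1 ℕ.+ n)
  mu   : ∀ {n} → Rec (1 ℕ.+ n) → Rec n

infix 4 _[_]⇓_

-- f [ xs ]⇓ y : the partial function denoted by f is defined at xs, with
-- value y.  In `prec g h` the recursion variable is the first argument, and
-- h receives the predecessor, the previous value and the parameters, in that
-- order; `mu f` minimises over the first argument of f.
data _[_]⇓_ : ∀ {n} → Rec n → Vec ℕ n → ℕ → Set where
  ⇓zer   : zer [ [] ]⇓ 0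
  ⇓succ  : ∀ {x} → succ [ x ∷ [] ]⇓ suc x
  ⇓proj  : ∀ {n} {xs : Vec ℕ n} i → proj i [ xs ]⇓ lookup xs i
  ⇓comp  : ∀ {m n} {f : Rec m} {gs : Vec (Rec n) m} {xs ys z} →
           Pointwise (λ g y → g [ xs ]⇓ y) gs ys → f [ ys ]⇓ z →
           comp f gs [ xs ]⇓ z
  ⇓prec₀ : ∀ {n} {g : Rec n} {h xs y} →
           g [ xs ]⇓ y → prec g h [ zero ∷ xs ]⇓ y
  ⇓precₛ : ∀ {n} {g : Rec n} {h xs k y z} →
           prec g h [ k ∷ xs ]⇓ y → h [ k ∷ y ∷ xs ]⇓ z →
           prec g h [ suc k ∷ xs ]⇓ z
  ⇓mu    : ∀ {n} {f : Rec (1 ℕ.+ n)} {xs k} →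
           (∀ j → j ℕ.< k → ∃ λ y → f [ j ∷ xs ]⇓ suc y) →
           f [ k ∷ xs ]⇓ 0 →
           mu f [ xs ]⇓ k

Computable : (ℕ → ℕ) → Set
Computable f = ∃ λ (c : Rec 1) → ∀ n → c [ n ∷ [] ]⇓ f n

-- A sequence of rationals is computable if it has the form
-- n ↦ (a(n) − b(n)) / (c(n) + 1) with a, b, c computable.
Computableℚ : (ℕ → ℚ) → Set
Computableℚ q =
  ∃ λ a → ∃ λ b → ∃ λ c →
    Computable a × Computable b × Computable c ×
    (∀ n → q n ≡ (a n ⊖ b n) / suc (c n))

------------------------------------------------------------------------
-- Real numbers: two-sided Dedekind cuts

-- L q means q < x, and U q means x < q.
record ℝ : Set₁ where
  field
    L U       : ℚ → Set
    L-inhab   : ∃ L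
    U-inhab   : ∃ U
    L-rounded : ∀ q → L q ⇔ (∃ λ r → q < r × L r)
    U-rounded : ∀ q → U q ⇔ (∃ λ r → r < q × U r)
    disjoint  : ∀ q → ¬ (L q × U q)
    located   : ∀ {q r} → q < r → L q ⊎ U r

open ℝ public

private
  0<1 : 0ℚ < 1ℚ
  0<1 = from-yes (0ℚ <? 1ℚ)

  -1<0 : - 1ℚ < 0ℚ
  -1<0 = from-yes (- 1ℚ <? 0ℚ)

fromℚ : ℚ → ℝ
fromℚ q = record
  { L         = _< q
  ; U         = q <_
  ; L-inhab   = q - 1ℚ , subst (q - 1ℚ <_) (+-identityʳ q) (+-monoʳ-< q -1<0)
  ; U-inhab   = q + 1ℚ , subst (_< q + 1ℚ) (+-identityʳ q) (+-monoʳ-< q 0<1)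
  ; L-rounded = λ p → mk⇔ (λ p<q → <-dense p<q)
                          (λ { (r , p<r , r<q) → <-trans p<r r<q })
  ; U-rounded = λ p → mk⇔ (λ q<p → let (r , q<r , r<p) = <-dense q<p in r , r<p , q<r)
                          (λ { (r , r<p , q<r) → <-trans q<r r<p })
  ; disjoint  = λ { p (p<q , q<p) → <-asym p<q q<p }
  ; located   = loc
  }
  where
  loc : ∀ {p r} → p < r → p < q ⊎ q < r
  loc {p} p<r with <-cmp p q
  ... | tri< p<q _ _  = inj₁ p<q
  ... | tri≈ _ refl _ = inj₂ p<r
  ... | tri> _ _ q<p  = inj₂ (<-trans q<p p<r)

-- x - q < ε
_⊝_<_ : ℝ → ℚ → ℚ → Set
x ⊝ q < ε = U x (q + ε)

-- |x - q| < ε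
∣_⊝_∣<_ : ℝ → ℚ → ℚ → Set
∣ x ⊝ q ∣< ε = L x (q - ε) × U x (q + ε)

------------------------------------------------------------------------
-- Convergence

2^-_ : ℕ → ℚ
2^- n = (1ℤ / (2 ℕ.^ n)) {{m^n≢0 2 n}}

infix 4 _⟶_

_⟶_ : (ℕ → ℚ) → ℝ → Set
q ⟶ x = ∀ ε → 0ℚ < ε → ∃ λ N → ∀ n → N ℕ.≤ n → ∣ x ⊝ q n ∣< ε

IsModulus : (ℕ → ℕ) → (ℕ → ℚ) → ℝ → Set
IsModulus f q x = ∀ n m → f n ℕ.≤ m → ∣ x ⊝ q m ∣< (2^- n)

ConvergesComputably : (ℕ → ℚ) → ℝ → Set
ConvergesComputably q x =
  q ⟶ x × ∃ λ f → Computable f × IsModulus f q x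

Increasing : (ℕ → ℕ) → Set
Increasing s = s Preserves ℕ._<_ ⟶ ℕ._<_

NonDecreasing : (ℕ → ℚ) → Set
NonDecreasing q = q Preserves ℕ._≤_ ⟶ _≤_

ConvergesNearlyComputably : (ℕ → ℚ) → ℝ → Set
ConvergesNearlyComputably q x =
  q ⟶ x ×
  (∀ s → Computable s → Increasing s →
     ConvergesComputably (λ n → q (s (suc n)) - q (s n)) (fromℚ 0ℚ))

------------------------------------------------------------------------
-- Classes of real numbers

LeftComputable : ℝ → Set
LeftComputable x = ∃ λ q → Computableℚ q × NonDecreasing q × q ⟶ x

NearlyComputable : ℝ → Set
NearlyComputable x = ∃ λ q → Computableℚ q × ConvergesNearlyComputably q x

RegaininglyApproximable : ℝ → Set
RegaininglyApproximable x =
  ∃ λ q → Computableℚ q × NonDecreasing q × q ⟶ x ×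
    (∀ m → ∃ λ n → m ℕ.≤ n × (x ⊝ q n < (2^- n)))

{-# OPTIONS --safe #-}

-- Let φ₀, φ₁, … be the partial computable functions; every computable function
-- is bounded by a total one among them.  The number x is a sum over classes
-- n = 0, 1, ….  Class n has a source for each e < n, which releases 2^-(n+e) as
-- soon as φₑ(0), …, φₑ(n) have converged.  If φₑ bounds r and the amounts
-- released for e reach x in almost all classes, then x ≥ x_r(N) + 2^-N for almost
-- all N; hence x is not regainingly approximable.
--
-- For near computability, what the source e releases must pass the stations
-- e, …, 0 of its class.  Station i cuts what it receives at stage t into 2^t
-- equal pieces and lets out one at a time, only while the lower stations are
-- empty, and only when φᵢ(u) has converged, u being the stage of the last move
-- in the class.  If φᵢ(u) bounds s(u+1) for an increasing s, then a value of s
-- lies between u and the present, so at most one piece leaves station i between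
-- s(k) and s(k+1).  As long as φᵢ has not converged on 0, …, n, station i of
-- class n lets everything pass; so a partial φᵢ blocks only finitely many
-- classes.  Each class moves only finitely often, so the blocked classes affect
-- the modulus of convergence only by a constant.
module Submission where

open import Defs
open import Axiom.ExcludedMiddle using (ExcludedMiddle)
open import Data.Product using (∃; _×_; _,_; proj₁; proj₂)
open import Level using (0ℓ)
open import Relation.Nullary using (¬_; yes; no; contradiction)
open import Data.Empty using (⊥; ⊥-elim)
open import Data.Fin using (Fin; zero; suc)
open import Data.Fin.Patterns using (0F; 1F; 2F; 3F; 4F)
open import Data.List as List using (List; []; _∷_)
open import Data.List.Relation.Unary.All using (All; []; _∷_)
open import Data.Nat as ℕ using (ℕ; zero; suc; s≤s; z≤n; pred; _^_; _∸_)
import Data.Nat.Properties as ℕ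
open import Data.Nat.Induction using (<-wellFounded)
open import Data.Sum using (_⊎_; inj₁; inj₂)
open import Data.Vec using (Vec; []; _∷_; lookup; replicate)
open import Data.Vec.Relation.Binary.Pointwise.Inductive using (Pointwise; []; _∷_)
open import Function using (_⇔_; mk⇔; Equivalence)
open import Induction.WellFounded using (Acc; acc; WellFounded)
open import Relation.Binary.PropositionalEquality

-- The weight 2^-(n+e) is chosen so that, for fixed e, every large N equals n + e with n = N - e >
-- e: a single source then supplies the whole jump 2^-N. If a monotone computable q came within
-- 2^-(N+1) of x at index N+1, waiting until the approximations of x catch up with q would compute a
-- stage from which x is less than 2^-N away, and the jump refutes this.
--
-- The obstacle for near computability is that the stage at which a class comes to rest is not
-- computable. The modulus waits instead for a recognisable configuration: stations 0, ..., i empty,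
-- with as many sources left as they keep in the end. Which of φ₀, ..., φᵢ are total is a finite
-- amount of information, built in as constants. Sources above i may still act later, but what they
-- release has to pass station i. Cutting into 2^t pieces makes whatever leaves station i after
-- stage T at most 2^-T in size, and the demand that the lower stations be empty leaves at most one
-- such piece in transit below i.
--
-- Excluded middle selects these constants, gives locatedness of the limit and shows that every
-- class comes to rest.

module Recursion where

  open import Data.Nat
  open import Data.Nat.Properties

  -- Combinators for μ-recursive functions

  Recursive : ∀ {n} → (Vec ℕ n → ℕ) → Set
  Recursive {n} f = ∃ λ (c : Rec n) → ∀ xs → c [ xs ]⇓ f xs

  Recursive₁ : (ℕ → ℕ) → Set
  Recursive₁ f = Recursive {1} λ xs → f (lookup xs 0F)

  Recursive₂ : (ℕ → ℕ → ℕ) → Set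
  Recursive₂ f = Recursive {2} λ xs → f (lookup xs 0F) (lookup xs 1F)

  Recursive₃ : (ℕ → ℕ → ℕ → ℕ) → Set
  Recursive₃ f = Recursive {3} λ xs → f (lookup xs 0F) (lookup xs 1F) (lookup xs 2F)

  private
    variable
      n : ℕ
      f g h k l : Vec ℕ n → ℕ

  ext : (∀ xs → f xs ≡ g xs) → Recursive f → Recursive g
  ext eq (c , p) = c , λ xs → subst (c [ xs ]⇓_) (eq xs) (p xs)

  fromComputable : ∀ {f} → Computable f → Recursive₁ f
  fromComputable (c , p) = c , λ { (x ∷ []) → p x }

  toComputable : ∀ {f} → Recursive₁ f → Computable f
  toComputable (c , p) = c , λ x → p (x ∷ [])

  var : (i : Fin n) → Recursive (λ xs → lookup xs i)
  var i = proj i , λ _ → ⇓proj i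

  app₁ : ∀ F → Recursive₁ F → Recursive f → Recursive (λ xs → F (f xs))
  app₁ F (c , p) (d , q) = comp c (d ∷ []) , λ xs → ⇓comp (q xs ∷ []) (p _)

  app₂ : ∀ F → Recursive₂ F → Recursive f → Recursive g →
         Recursive (λ xs → F (f xs) (g xs))
  app₂ F (c , p) (d , q) (d′ , q′) =
    comp c (d ∷ d′ ∷ []) , λ xs → ⇓comp (q xs ∷ q′ xs ∷ []) (p _)

  app₃ : ∀ F → Recursive₃ F → Recursive f → Recursive g → Recursive h →
         Recursive (λ xs → F (f xs) (g xs) (h xs))
  app₃ F (c , p) (d , q) (d′ , q′) (d″ , q″) =
    comp c (d ∷ d′ ∷ d″ ∷ []) , λ xs → ⇓comp (q xs ∷ q′ xs ∷ q″ xs ∷ []) (p _)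

  natrec : ∀ {A : Set} → A → (ℕ → A → A) → ℕ → A
  natrec z s zero    = z
  natrec z s (suc n) = s n (natrec z s n)

  projections : ∀ {m} → (Fin m → Fin n) → Vec (Rec n) m
  projections {m = zero}  ρ = []
  projections {m = suc m} ρ = proj (ρ zero) ∷ projections (λ i → ρ (suc i))

  ⇓projections : ∀ {m} (ρ : Fin m → Fin n) (xs : Vec ℕ n) (ys : Vec ℕ m) →
                 (∀ i → lookup xs (ρ i) ≡ lookup ys i) →
                 Pointwise (λ g y → g [ xs ]⇓ y) (projections ρ) ys
  ⇓projections ρ xs []       eq = []
  ⇓projections ρ xs (y ∷ ys) eq =
    subst (proj (ρ zero) [ xs ]⇓_) (eq zero) (⇓proj (ρ zero)) ∷
    ⇓projections (λ i → ρ (suc i)) xs ys (λ i → eq (suc i))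

  rec : ∀ {z : Vec ℕ n → ℕ} {s : Vec ℕ (2 + n) → ℕ} →
        Recursive z → Recursive s → Recursive k →
        Recursive (λ xs → natrec (z xs) (λ j a → s (j ∷ a ∷ xs)) (k xs))
  rec {n = n} {k = k} {z = z} {s} (cz , pz) (cs , ps) (ck , pk) =
    comp (prec cz cs) (ck ∷ projections λ i → i) ,
    λ xs → ⇓comp (pk xs ∷ ⇓projections (λ i → i) xs xs (λ _ → refl)) (loop xs (k xs))
    where
    loop : ∀ xs m → prec cz cs [ m ∷ xs ]⇓ natrec (z xs) (λ j a → s (j ∷ a ∷ xs)) m
    loop xs zero    = ⇓prec₀ (pz xs)
    loop xs (suc m) = ⇓precₛ (loop xs m) (ps _)

  -- Mirrors the premises of `⇓mu`, so that a least zero is directly a derivation.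
  Least : (ℕ → ℕ) → ℕ → Set
  Least p k = (∀ j → j < k → ∃ λ y → p j ≡ suc y) × p k ≡ 0

  least : (p : ℕ → ℕ) → (∃ λ k → p k ≡ 0) → ∃ (Least p)
  least p (k , pk) = search k 0 (+-identityʳ k) λ _ ()
    where
    search : ∀ m j → m + j ≡ k → (∀ i → i < j → ∃ λ y → p i ≡ suc y) → ∃ (Least p)
    search zero    j refl below = j , below , pk
    search (suc m) j eq   below with p j in pj
    ... | zero  = j , below , pj
    ... | suc y = search m (suc j) (trans (+-suc m j) eq) below′
      where
      below′ : ∀ i → i < suc j → ∃ λ y → p i ≡ suc y
      below′ i i<1+j with m≤n⇒m<n∨m≡n (s≤s⁻¹ i<1+j)
      ... | inj₁ i<j  = below i i<j
      ... | inj₂ refl = y , pj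

  minimise : ∀ {p : Vec ℕ (suc n) → ℕ} → Recursive p → (∀ xs → ∃ λ k → p (k ∷ xs) ≡ 0) →
             ∃ λ (f : Vec ℕ n → ℕ) → Recursive f × (∀ xs → p (f xs ∷ xs) ≡ 0)
  minimise {p = p} (c , q) ex =
    (λ xs → proj₁ (lst xs)) ,
    (mu c , λ xs → let (k , below , pk) = lst xs in
       ⇓mu (λ j j<k → let (y , e) = below j j<k in y , subst (c [ j ∷ xs ]⇓_) e (q _))
           (subst (c [ k ∷ xs ]⇓_) pk (q _))) ,
    λ xs → proj₂ (proj₂ (lst xs))
    where
    lst : ∀ xs → ∃ (Least (λ k → p (k ∷ xs)))
    lst xs = least _ (ex xs)

  zeroᶜ : Recursive {n} (λ _ → 0)
  zeroᶜ = comp zer [] , λ _ → ⇓comp [] ⇓zer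

  sucᶜ : Recursive f → Recursive (λ xs → suc (f xs))
  sucᶜ = app₁ suc (succ , λ { (x ∷ []) → ⇓succ })

  constᶜ : ∀ m → Recursive {n} (λ _ → m)
  constᶜ zero    = zeroᶜ
  constᶜ (suc m) = sucᶜ (constᶜ m)

  ite : ∀ {A : Set} → ℕ → A → A → A
  ite zero    a b = b
  ite (suc _) a b = a

  iteᶜ : Recursive f → Recursive g → Recursive h → Recursive (λ xs → ite (f xs) (g xs) (h xs))
  iteᶜ = app₃ ite
    (ext (λ { (zero ∷ _ ∷ _ ∷ []) → refl ; (suc _ ∷ _ ∷ _ ∷ []) → refl })
         (rec (var 2F) (var 3F) (var 0F)))

  predᶜ : Recursive f → Recursive (λ xs → pred (f xs))
  predᶜ = app₁ pred
    (ext (λ { (zero ∷ []) → refl ; (suc _ ∷ []) → refl }) (rec zeroᶜ (var 0F) (var 0F)))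

  infixl 6 _+ᶜ_ _∸ᶜ_
  infixl 7 _*ᶜ_

  _+ᶜ_ : Recursive f → Recursive g → Recursive (λ xs → f xs + g xs)
  _+ᶜ_ = app₂ _+_
    (ext (λ { (m ∷ k ∷ []) → lem m k }) (rec (var 1F) (sucᶜ (var 1F)) (var 0F)))
    where
    lem : ∀ m k → natrec k (λ _ → suc) m ≡ m + k
    lem zero    k = refl
    lem (suc m) k = cong suc (lem m k)

  _*ᶜ_ : Recursive f → Recursive g → Recursive (λ xs → f xs * g xs)
  _*ᶜ_ = app₂ _*_
    (ext (λ { (m ∷ k ∷ []) → lem m k }) (rec zeroᶜ (var 3F +ᶜ var 1F) (var 0F)))
    where
    lem : ∀ m k → natrec 0 (λ _ a → k + a) m ≡ m * k
    lem zero    k = refl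
    lem (suc m) k = cong (k +_) (lem m k)

  _∸ᶜ_ : Recursive f → Recursive g → Recursive (λ xs → f xs ∸ g xs)
  _∸ᶜ_ = app₂ _∸_
    (ext (λ { (m ∷ k ∷ []) → lem m k }) (rec (var 0F) (predᶜ (var 1F)) (var 1F)))
    where
    lem : ∀ m k → natrec m (λ _ → pred) k ≡ m ∸ k
    lem m zero    = refl
    lem m (suc k) = trans (cong pred (lem m k)) (pred[m∸n]≡m∸[1+n] m k)

  2^ᶜ : Recursive f → Recursive (λ xs → 2 ^ f xs)
  2^ᶜ = app₁ (2 ^_)
    (ext (λ { (m ∷ []) → lem m }) (rec (constᶜ 1) (constᶜ 2 *ᶜ var 1F) (var 0F)))
    where
    lem : ∀ m → natrec 1 (λ _ a → 2 * a) m ≡ 2 ^ m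
    lem zero    = refl
    lem (suc m) = cong (2 *_) (lem m)

  -- Integer square roots and a pairing function

  abstract
    -- The integer square root; the condition of `ite` is positive exactly when (a+1)² ≤ z+1, that
    -- is, when the root grows.
    root : ℕ → ℕ
    root = natrec 0 λ z a → ite (suc (suc z) ∸ suc a * suc a) (suc a) a

    rootᶜ : Recursive f → Recursive (λ xs → root (f xs))
    rootᶜ = rec zeroᶜ
      (iteᶜ (sucᶜ (sucᶜ (var 0F)) ∸ᶜ sucᶜ (var 1F) *ᶜ sucᶜ (var 1F)) (sucᶜ (var 1F)) (var 1F))

    root-spec : ∀ z → root z * root z ≤ z × z < suc (root z) * suc (root z)
    root-spec zero    = z≤n , s≤s z≤n
    root-spec (suc z) with root-spec z
    ... | lo , hi with suc (suc z) ∸ suc (root z) * suc (root z) in eq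
    ... | zero  = m≤n⇒m≤1+n lo , m∸n≡0⇒m≤n eq
    ... | suc y = s≤s⁻¹ (m∸n≢0⇒n<m λ e → contradiction (trans (sym e) eq) λ ()) ,
                  ≤-<-trans hi (*-mono-< (n<1+n (suc (root z))) (n<1+n (suc (root z))))

    -- The value lies between (a+b)² and (a+b+1)², so the root recovers a + b and the remainder is
    -- a.
    pair : ℕ → ℕ → ℕ
    pair a b = (a + b) * (a + b) + a

    left right : ℕ → ℕ
    left z = z ∸ root z * root z
    right z = root z ∸ left z

    root-unique : ∀ a b z → a * a ≤ z → z < suc a * suc a → b * b ≤ z → z < suc b * suc b → a ≡ b
    root-unique a b z a≤ <a b≤ <b = ≤-antisym (below a≤ <b) (below b≤ <a)
      where
      below : ∀ {a b} → a * a ≤ z → z < suc b * suc b → a ≤ b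
      below {a} {b} a≤ <b with a ≤? b
      ... | yes a≤b = a≤b
      ... | no  a≰b = ⊥-elim (<-irrefl refl (<-≤-trans <b (≤-trans (*-mono-≤ (≰⇒> a≰b) (≰⇒> a≰b)) a≤)))

    root-pair : ∀ a b → root (pair a b) ≡ a + b
    root-pair a b = root-unique _ _ (pair a b) (proj₁ (root-spec _)) (proj₂ (root-spec _))
      (m≤m+n _ a) (s≤s (≤-trans (+-monoʳ-≤ ((a + b) * (a + b)) (m≤m+n a b))
        (≤-trans (m≤n+m _ (a + b)) (≤-reflexive (trans (cong (a + b +_) (+-comm _ (a + b)))
           (cong (a + b +_) (sym (*-suc (a + b) (a + b)))))))))

    left-pair : ∀ a b → left (pair a b) ≡ a
    left-pair a b = trans (cong (λ r → pair a b ∸ r * r) (root-pair a b)) (m+n∸m≡n ((a + b) * (a + b)) a)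

    right-pair : ∀ a b → right (pair a b) ≡ b
    right-pair a b = trans (cong₂ _∸_ (root-pair a b) (left-pair a b)) (m+n∸m≡n a b)

    pairᶜ : Recursive f → Recursive g → Recursive (λ xs → pair (f xs) (g xs))
    pairᶜ p q = (p +ᶜ q) *ᶜ (p +ᶜ q) +ᶜ p

    leftᶜ : Recursive f → Recursive (λ xs → left (f xs))
    leftᶜ p = p ∸ᶜ rootᶜ p *ᶜ rootᶜ p

    rightᶜ : Recursive f → Recursive (λ xs → right (f xs))
    rightᶜ p = rootᶜ p ∸ᶜ leftᶜ p

  -- A stack machine on codes

  switch : ℕ → List ℕ → ℕ
  switch t []       = 0
  switch t (b ∷ bs) = ite t (switch (pred t) bs) b

  switchᶜ : ∀ {n} {f : Vec ℕ n → ℕ} {gs} → Recursive f → All Recursive gs →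
            Recursive (λ xs → switch (f xs) (List.map (λ g → g xs) gs))
  switchᶜ p []       = zeroᶜ
  switchᶜ p (q ∷ qs) = iteᶜ p (switchᶜ (predᶜ p) qs) q

  -- A configuration is pair v K, where v is the current value and K a stack of
  -- instructions: 0 is the empty stack and push i K has top i.
  push : ℕ → ℕ → ℕ
  push i K = suc (pair i K)

  instr : ℕ → ℕ → ℕ → ℕ
  instr tag x y = pair tag (pair x y)

  -- Tags 7 and 8 occur only on the stack: they hold the input, respectively the
  -- first component, while a pair is being computed.
  exec : ℕ → ℕ → ℕ → ℕ → ℕ → ℕ
  exec tag x y v K = switch tag
    ( pair 0 K
    ∷ pair (suc v) K
    ∷ pair (pred v) K
    ∷ pair (left v) K
    ∷ pair (right v) K
    ∷ pair v (push x (push (instr 7 y v) K))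
    ∷ pair v (push y (push x K))
    ∷ pair y (push x (push (instr 8 v 0) K))
    ∷ pair (pair x v) K
    ∷ ite (left v) (pair v (push x (push (instr 9 x y) K))) (pair (right v) K)
    ∷ [])

  next : ℕ → ℕ
  next z = ite (right z) (run-top (pred (right z))) z
    where
    run-top : ℕ → ℕ
    run-top k = exec (left (left k)) (left (right (left k))) (right (right (left k)))
                     (left z) (right k)

  next-push : ∀ tag x y v K → next (pair v (push (instr tag x y) K)) ≡ exec tag x y v K
  next-push tag x y v K
    rewrite right-pair v (push (instr tag x y) K) | left-pair v (push (instr tag x y) K)
          | right-pair (instr tag x y) K | left-pair (instr tag x y) K
          | left-pair tag (pair x y) | right-pair tag (pair x y)
          | left-pair x y | right-pair x y = refl

  next-halted : ∀ {z} → right z ≡ 0 → next z ≡ z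
  next-halted eq rewrite eq = refl

  pushᶜ : Recursive f → Recursive g → Recursive (λ xs → push (f xs) (g xs))
  pushᶜ p q = sucᶜ (pairᶜ p q)

  instrᶜ : Recursive f → Recursive g → Recursive h →
           Recursive (λ xs → instr (f xs) (g xs) (h xs))
  instrᶜ p q r = pairᶜ p (pairᶜ q r)

  execᶜ : Recursive f → Recursive g → Recursive h → Recursive k → Recursive l →
          Recursive (λ xs → exec (f xs) (g xs) (h xs) (k xs) (l xs))
  execᶜ tag x y v K = switchᶜ tag
    ( pairᶜ zeroᶜ K
    ∷ pairᶜ (sucᶜ v) K
    ∷ pairᶜ (predᶜ v) K
    ∷ pairᶜ (leftᶜ v) K
    ∷ pairᶜ (rightᶜ v) K
    ∷ pairᶜ v (pushᶜ x (pushᶜ (instrᶜ (constᶜ 7) y v) K))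
    ∷ pairᶜ v (pushᶜ y (pushᶜ x K))
    ∷ pairᶜ y (pushᶜ x (pushᶜ (instrᶜ (constᶜ 8) v zeroᶜ) K))
    ∷ pairᶜ (pairᶜ x v) K
    ∷ iteᶜ (leftᶜ v) (pairᶜ v (pushᶜ x (pushᶜ (instrᶜ (constᶜ 9) x y) K))) (pairᶜ (rightᶜ v) K)
    ∷ [])

  stepᶜ : Recursive f → Recursive (λ xs → next (f xs))
  stepᶜ z = iteᶜ (rightᶜ z)
    (execᶜ (leftᶜ i) (leftᶜ (rightᶜ i)) (rightᶜ (rightᶜ i)) (leftᶜ z) (rightᶜ top)) z
    where
    top = predᶜ (rightᶜ z)
    i = leftᶜ top

  steps : ℕ → ℕ → ℕ
  steps z = natrec z (λ _ → next)

  steps-+ : ∀ z t t′ → steps (steps z t) t′ ≡ steps z (t′ + t)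
  steps-+ z t zero     = refl
  steps-+ z t (suc t′) = cong next (steps-+ z t t′)

  steps-halted : ∀ {z t t′} → right (steps z t) ≡ 0 → t ≤ t′ → steps z t′ ≡ steps z t
  steps-halted {z} {t} {t′} halted t≤t′ = begin
    steps z t′              ≡⟨ cong (steps z) (m∸n+n≡m t≤t′) ⟨
    steps z (t′ ∸ t + t)    ≡⟨ steps-+ z t (t′ ∸ t) ⟨
    steps (steps z t) (t′ ∸ t) ≡⟨ stay (t′ ∸ t) ⟩
    steps z t               ∎
    where
    open ≡-Reasoning
    stay : ∀ k → steps (steps z t) k ≡ steps z t
    stay zero    = refl
    stay (suc k) = trans (cong next (stay k)) (next-halted halted)

  infix 4 _⟿_

  _⟿_ : ℕ → ℕ → Set
  z ⟿ z′ = ∃ λ t → steps z t ≡ z′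

  ⟿-trans : ∀ {z z′ z″} → z ⟿ z′ → z′ ⟿ z″ → z ⟿ z″
  ⟿-trans {z} (t , refl) (t′ , refl) = t′ + t , sym (steps-+ z t t′)

  one-step : ∀ tag x y v K → pair v (push (instr tag x y) K) ⟿ exec tag x y v K
  one-step tag x y v K = 1 , next-push tag x y v K

  -- Quantifying over the rest `K` of the stack makes runs compose: the continuation of an
  -- instruction is just more stack.
  _⟨_⟩↝_ : ℕ → ℕ → ℕ → Set
  i ⟨ v ⟩↝ w = ∀ K → pair v (push i K) ⟿ pair w K

  `zero `suc `pred `left `right : ℕ
  `zero  = instr 0 0 0
  `suc   = instr 1 0 0
  `pred  = instr 2 0 0
  `left  = instr 3 0 0
  `right = instr 4 0 0

  `pair `comp : ℕ → ℕ → ℕ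
  `pair = instr 5
  `comp = instr 6

  -- A while loop on pairs of a flag and a payload: as long as the flag is nonzero, `c` runs on the
  -- whole pair and has to produce the next one; flag 0 exits with the payload.
  `loop : ℕ → ℕ
  `loop c = instr 9 c 0

  infixr 9 _`∘_
  _`∘_ = `comp

  `id : ℕ
  `id = `pred `∘ `suc

  run-zero : ∀ {v} → `zero ⟨ v ⟩↝ 0
  run-zero K = one-step 0 0 0 _ K

  run-suc : ∀ {v} → `suc ⟨ v ⟩↝ suc v
  run-suc K = one-step 1 0 0 _ K

  run-pred : ∀ {v} → `pred ⟨ v ⟩↝ pred v
  run-pred K = one-step 2 0 0 _ K

  run-left : ∀ {v w} → `left ⟨ pair v w ⟩↝ v
  run-left {v} {w} K =
    subst (λ x → pair (pair v w) (push `left K) ⟿ pair x K) (left-pair v w) (one-step 3 0 0 _ K)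

  run-right : ∀ {v w} → `right ⟨ pair v w ⟩↝ w
  run-right {v} {w} K =
    subst (λ x → pair (pair v w) (push `right K) ⟿ pair x K) (right-pair v w) (one-step 4 0 0 _ K)

  run-pair : ∀ {c d v a b} → c ⟨ v ⟩↝ a → d ⟨ v ⟩↝ b → `pair c d ⟨ v ⟩↝ pair a b
  run-pair {c} {d} {v} {a} {b} p q K =
    ⟿-trans (one-step 5 c d v K) (⟿-trans (p _) (⟿-trans (one-step 7 d v a K)
      (⟿-trans (q _) (one-step 8 a 0 b K))))

  run-∘ : ∀ {c d v w x} → d ⟨ v ⟩↝ w → c ⟨ w ⟩↝ x → (c `∘ d) ⟨ v ⟩↝ x
  run-∘ {c} {d} {v} p q K = ⟿-trans (one-step 6 c d v K) (⟿-trans (p _) (q K))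

  run-id : ∀ {v} → `id ⟨ v ⟩↝ v
  run-id = run-∘ run-suc run-pred

  run-loop-stop : ∀ {c v} → `loop c ⟨ pair 0 v ⟩↝ v
  run-loop-stop {c} {v} K = subst (pair (pair 0 v) (push (`loop c) K) ⟿_) eq (one-step 9 c 0 _ K)
    where
    eq : exec 9 c 0 (pair 0 v) K ≡ pair v K
    eq rewrite left-pair 0 v | right-pair 0 v = refl

  run-loop-step : ∀ {c m v w x} → c ⟨ pair (suc m) v ⟩↝ w → `loop c ⟨ w ⟩↝ x →
                  `loop c ⟨ pair (suc m) v ⟩↝ x
  run-loop-step {c} {m} {v} p q K =
    ⟿-trans (subst (pair (pair (suc m) v) (push (`loop c) K) ⟿_) eq (one-step 9 c 0 _ K))
            (⟿-trans (p _) (q K))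
    where
    eq : exec 9 c 0 (pair (suc m) v) K ≡ pair (pair (suc m) v) (push c (push (`loop c) K))
    eq rewrite left-pair (suc m) v = refl

  -- Compilation of μ-recursive functions

  tuple : Vec ℕ n → ℕ
  tuple []       = 0
  tuple (x ∷ xs) = pair x (tuple xs)

  -- Loop states: for primitive recursion, the rounds left (which serve as the flag), the rounds
  -- done, the accumulator and the parameters; for minimisation, the last value of f (the flag), the
  -- candidate and the parameters.
  `prec-body `mu-start `mu-body : ℕ → ℕ
  `prec-body h = `pair (`pred `∘ `left)
                (`pair (`suc `∘ `left `∘ `right)
                (`pair (h `∘ `right) (`right `∘ `right `∘ `right)))
  `mu-start f = `pair f `id
  `mu-body f = `mu-start f `∘ `pair (`suc `∘ `left `∘ `right) (`right `∘ `right)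

  compile : Rec n → ℕ
  compile* : ∀ {m} → Vec (Rec n) m → ℕ

  compile zer            = `zero
  compile succ           = `suc `∘ `left
  compile (proj zero)    = `left
  compile (proj (suc i)) = compile (proj i) `∘ `right
  compile (comp f gs)    = compile f `∘ compile* gs
  compile (prec g h)     = (`left `∘ `right) `∘ `loop (`prec-body (compile h)) `∘
                           `pair `left (`pair `zero (`pair (compile g `∘ `right) `right))
  compile (mu f)         = `left `∘ `loop (`mu-body (compile f)) `∘
                           `mu-start (compile f) `∘ `pair `zero `id

  compile* []       = `zero
  compile* (g ∷ gs) = `pair (compile g) (compile* gs)

  run-proj : ∀ (i : Fin n) xs → compile (proj i) ⟨ tuple xs ⟩↝ lookup xs i
  run-proj zero    (x ∷ xs) = run-left
  run-proj (suc i) (x ∷ xs) = run-∘ run-right (run-proj i xs)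

  run-prec-body : ∀ {c m j a v w} → c ⟨ pair j (pair a v) ⟩↝ w →
    `prec-body c ⟨ pair (suc m) (pair j (pair a v)) ⟩↝ pair m (pair (suc j) (pair w v))
  run-prec-body p = run-pair (run-∘ run-left run-pred)
    (run-pair (run-∘ (run-∘ run-right run-left) run-suc)
      (run-pair (run-∘ run-right p) (run-∘ (run-∘ run-right run-right) run-right)))

  run-mu-body : ∀ {c b j v w} → c ⟨ pair (suc j) v ⟩↝ w →
    `mu-body c ⟨ pair b (pair j v) ⟩↝ pair w (pair (suc j) v)
  run-mu-body p = run-∘ (run-pair (run-∘ (run-∘ run-right run-left) run-suc) (run-∘ run-right run-right))
    (run-pair p run-id)

  tuple-run : ∀ {c : Rec n} {xs y} → c [ xs ]⇓ y → compile c ⟨ tuple xs ⟩↝ y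
  tuple-run* : ∀ {m} {gs : Vec (Rec n) m} {xs ys} →
               Pointwise (λ g y → g [ xs ]⇓ y) gs ys → compile* gs ⟨ tuple xs ⟩↝ tuple ys
  -- A derivation for k unwinds from its last round, while the machine starts with the first.
  -- Allowing `m` further rounds after the k makes the induction on the derivation go through.
  run-prec : ∀ {g : Rec n} {h xs k y} → prec g h [ k ∷ xs ]⇓ y →
    ∃ λ y₀ → (compile g ⟨ tuple xs ⟩↝ y₀) × (∀ m {w} →
      `loop (`prec-body (compile h)) ⟨ pair m (pair k (pair y (tuple xs))) ⟩↝ w →
      `loop (`prec-body (compile h)) ⟨ pair (k + m) (pair 0 (pair y₀ (tuple xs))) ⟩↝ w)

  tuple-run ⇓zer         = run-zero
  tuple-run (⇓succ)      = run-∘ run-left run-suc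
  tuple-run {xs = xs} (⇓proj i) = run-proj i xs
  tuple-run (⇓comp ps p) = run-∘ (tuple-run* ps) (tuple-run p)
  tuple-run {xs = k ∷ xs} (⇓prec₀ p) =
    run-∘ (run-∘ (run-pair run-left (run-pair run-zero (run-pair (run-∘ run-right (tuple-run p)) run-right)))
                 run-loop-stop)
          (run-∘ run-right run-left)
  tuple-run {xs = suc k ∷ xs} {y = y} d@(⇓precₛ {h = h} _ _) =
    let y₀ , p , q = run-prec d in
    run-∘ (run-∘ (run-pair run-left (run-pair run-zero (run-pair (run-∘ run-right p) run-right)))
                 (subst (λ m → `loop (`prec-body (compile h)) ⟨ pair m (pair 0 (pair y₀ (tuple xs))) ⟩↝
                               pair (suc k) (pair y (tuple xs)))
                        (+-identityʳ (suc k)) (q 0 run-loop-stop)))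
          (run-∘ run-right run-left)
  tuple-run {xs = xs} (⇓mu {f = f} {k = k} below p) =
    let v , q , r = from k 0 (+-identityʳ k) in
    run-∘ (run-∘ (run-∘ (run-pair run-zero run-id) (run-pair q run-id)) r) run-left
    where
    from : ∀ i j → i + j ≡ k → ∃ λ v → (compile f ⟨ pair j (tuple xs) ⟩↝ v) ×
      (`loop (`mu-body (compile f)) ⟨ pair v (pair j (tuple xs)) ⟩↝ pair k (tuple xs))
    from zero    j refl = 0 , tuple-run p , run-loop-stop
    from (suc i) j eq with below j (subst (j <_) eq (s≤s (m≤n+m j i))) | from i (suc j) (trans (+-suc i j) eq)
    ... | y , d | v , q , r = suc y , tuple-run d , run-loop-step (run-mu-body q) r

  tuple-run* []       = run-zero
  tuple-run* (p ∷ ps) = run-pair (tuple-run p) (tuple-run* ps)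

  run-prec (⇓prec₀ {y = y} p) = y , tuple-run p , λ m q → q
  run-prec {xs = xs} (⇓precₛ {h = h} {k = k} p p′) =
    let y₀ , q , r = run-prec p in
    y₀ , q , λ m {w} q′ →
      subst (λ m → `loop (`prec-body (compile h)) ⟨ pair m (pair 0 (pair y₀ (tuple xs))) ⟩↝ w)
            (+-suc k m) (r (suc m) (run-loop-step (run-prec-body (tuple-run p′)) q′))

  -- Stages of convergence

  start : ℕ → ℕ → ℕ
  start i x = pair (tuple (x ∷ [])) (push i 0)

  -- The second summand delays convergence until the stage has reached the value. The time of
  -- convergence thereby bounds the value itself, which is what `Bounds` expresses.
  pending : ℕ → ℕ → ℕ → ℕ
  pending i x t = right (steps (start i x) t) + (left (steps (start i x) t) ∸ t)

  -- τ i x t vanishes iff the i-th machine has halted by stage t on all inputs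
  -- up to x, with values at most t.
  τ : ℕ → ℕ → ℕ → ℕ
  τ i zero    t = pending i 0 t
  τ i (suc x) t = pending i (suc x) t + τ i x t

  pending-mono : ∀ i x {t t′} → pending i x t ≡ 0 → t ≤ t′ → pending i x t′ ≡ 0
  pending-mono i x {t} {t′} eq t≤t′ = cong₂ _+_
    (trans (cong right same) halted)
    (m≤n⇒m∸n≡0 (≤-trans (≤-trans (≤-reflexive (cong left same)) (m∸n≡0⇒m≤n small)) t≤t′))
    where
    halted = m+n≡0⇒m≡0 (right (steps (start i x) t)) eq
    small  = m+n≡0⇒n≡0 (right (steps (start i x) t)) eq
    same   = steps-halted {start i x} halted t≤t′

  τ-mono : ∀ i x {t t′} → τ i x t ≡ 0 → t ≤ t′ → τ i x t′ ≡ 0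
  τ-mono i zero    eq t≤t′ = pending-mono i 0 eq t≤t′
  τ-mono i (suc x) {t} eq t≤t′ = cong₂ _+_
    (pending-mono i (suc x) (m+n≡0⇒m≡0 _ eq) t≤t′)
    (τ-mono i x (m+n≡0⇒n≡0 (pending i (suc x) t) eq) t≤t′)

  τ⇒pending : ∀ {i} x t → τ i x t ≡ 0 → pending i x t ≡ 0
  τ⇒pending zero    t eq = eq
  τ⇒pending (suc x) t eq = m+n≡0⇒m≡0 _ eq

  τ-pred : ∀ i x t → τ i (suc x) t ≡ 0 → τ i x t ≡ 0
  τ-pred i x t = m+n≡0⇒n≡0 (pending i (suc x) t)

  τ-antitone : ∀ i {x y} t → y ≤ x → τ i x t ≡ 0 → τ i y t ≡ 0
  τ-antitone i {x} {y} t y≤x eq with m≤n⇒m<n∨m≡n y≤x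
  τ-antitone i         t y≤x eq | inj₂ refl = eq
  τ-antitone i {suc x} t y≤x eq | inj₁ y<x = τ-antitone i t (s≤s⁻¹ y<x) (τ-pred i x t eq)

  startᶜ : Recursive f → Recursive g → Recursive (λ xs → start (f xs) (g xs))
  startᶜ p q = pairᶜ (pairᶜ q zeroᶜ) (pushᶜ p zeroᶜ)

  pendingᶜ : Recursive f → Recursive g → Recursive h → Recursive (λ xs → pending (f xs) (g xs) (h xs))
  pendingᶜ = app₃ pending (rightᶜ z +ᶜ (leftᶜ z ∸ᶜ var 2F))
    where z = rec (startᶜ (var 0F) (var 1F)) (stepᶜ (var 1F)) (var 2F)

  τᶜ : Recursive f → Recursive g → Recursive h → Recursive (λ xs → τ (f xs) (g xs) (h xs))
  τᶜ = app₃ τ (ext eq (rec (pendingᶜ (var 0F) zeroᶜ (var 2F))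
      (pendingᶜ (var 2F) (sucᶜ (var 0F)) (var 4F) +ᶜ var 1F) (var 1F)))
    where
    lem : ∀ i x t → natrec (pending i 0 t) (λ j a → pending i (suc j) t + a) x ≡ τ i x t
    lem i zero    t = refl
    lem i (suc x) t = cong (pending i (suc x) t +_) (lem i x t)
    eq : ∀ xs → natrec (pending (lookup xs 0F) 0 (lookup xs 2F))
                       (λ j a → pending (lookup xs 0F) (suc j) (lookup xs 2F) + a) (lookup xs 1F)
                ≡ τ (lookup xs 0F) (lookup xs 1F) (lookup xs 2F)
    eq xs = lem (lookup xs 0F) (lookup xs 1F) (lookup xs 2F)

  Total : ℕ → Set
  Total i = ∀ x → ∃ λ t → τ i x t ≡ 0

  Bounds : ℕ → (ℕ → ℕ) → Set
  Bounds i f = ∀ x t → τ i x t ≡ 0 → f x ≤ t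

  pending-computes : ∀ {i x y t} → right (steps (start i x) t) ≡ 0 → left (steps (start i x) t) ≡ y →
                     ∀ t′ → pending i x t′ ≡ 0 → y ≤ t′
  pending-computes {i} {x} {t = t} halted refl t′ eq =
    ≤-trans (≤-reflexive (cong left same)) (m∸n≡0⇒m≤n (m+n≡0⇒n≡0 (right (steps (start i x) t′)) eq))
    where
    halted′ = m+n≡0⇒m≡0 (right (steps (start i x) t′)) eq
    same : steps (start i x) t ≡ steps (start i x) t′
    same with ≤-total t t′
    ... | inj₁ t≤t′ = sym (steps-halted {start i x} halted t≤t′)
    ... | inj₂ t′≤t = steps-halted {start i x} halted′ t′≤t

  -- The compiled code of f halts on every input with value `f x`; by the value test in `pending`,
  -- convergence on x cannot be seen before stage `f x`.
  dominate : ∀ {f} → Computable f → ∃ λ i → Total i × Bounds i f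
  dominate {f} (c , computes) = i , total , bounds
    where
    i = compile c
    halts : ∀ x → ∃ λ t → steps (start i x) t ≡ pair (f x) 0
    halts x = tuple-run (computes x) 0
    halted : ∀ x → right (steps (start i x) (proj₁ (halts x))) ≡ 0
    halted x = trans (cong right (proj₂ (halts x))) (right-pair (f x) 0)
    value : ∀ x → left (steps (start i x) (proj₁ (halts x))) ≡ f x
    value x = trans (cong left (proj₂ (halts x))) (left-pair (f x) 0)
    finished : ∀ x → ∃ λ t → pending i x t ≡ 0
    finished x = t + f x , cong₂ _+_ (trans (cong right same) (halted x))
        (m≤n⇒m∸n≡0 (≤-trans (≤-reflexive (trans (cong left same) (value x))) (m≤n+m (f x) t)))
      where
      t = proj₁ (halts x)
      same = steps-halted {start i x} (halted x) (m≤m+n t (f x))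
    total : Total i
    total zero    = finished 0
    total (suc x) = t + t′ , cong₂ _+_ (pending-mono i (suc x) p (m≤m+n t t′)) (τ-mono i x q (m≤n+m t′ t))
      where
      t = proj₁ (finished (suc x)); p = proj₂ (finished (suc x))
      t′ = proj₁ (total x); q = proj₂ (total x)
    bounds : Bounds i f
    bounds x t eq = pending-computes {t = proj₁ (halts x)} (halted x) (value x) t (τ⇒pending x t eq)

open Recursion
open import Data.Integer as ℤ using (ℤ; +_; _⊖_; 1ℤ; 0ℤ)
import Data.Integer.Properties as ℤ
open import Data.Rational
  using (ℚ; mkℚ; 0ℚ; 1ℚ; _+_; _-_; -_; _/_; _≤_; _<_; *<*; toℚᵘ)
open import Data.Rational.Properties
open import Data.Rational.Solver using (module +-*-Solver)
import Data.Rational.Unnormalised as ℚᵘ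
import Data.Rational.Unnormalised.Properties as ℚᵘ
open import Algebra.Properties.CommutativeMonoid.Mult +-0-commutativeMonoid
  using () renaming (_×_ to infixr 7 _·_; ×-homo-+ to ·-homo-+; ×-assocˡ to ·-assoc; ×-distrib-+ to ·-distrib-+)

-- Arithmetic of dyadic rationals

toℚᵘ-/ : ∀ i d → toℚᵘ (i / suc d) ℚᵘ.≃ ℚᵘ.mkℚᵘ i d
toℚᵘ-/ i d = toℚᵘ-fromℚᵘ (ℚᵘ.mkℚᵘ i d)

/-+-same : ∀ i j d → i / suc d + j / suc d ≡ (i ℤ.+ j) / suc d
/-+-same i j d = toℚᵘ-injective (ℚᵘ.≃-trans (toℚᵘ-homo-+ (i / suc d) (j / suc d))
  (ℚᵘ.≃-trans (ℚᵘ.+-cong (toℚᵘ-/ i d) (toℚᵘ-/ j d))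
  (ℚᵘ.≃-trans (ℚᵘ.*≡* eq) (ℚᵘ.≃-sym (toℚᵘ-/ (i ℤ.+ j) d)))))
  where
  D = + suc d
  eq : (i ℤ.* D ℤ.+ j ℤ.* D) ℤ.* D ≡ (i ℤ.+ j) ℤ.* (D ℤ.* D)
  eq = trans (cong (ℤ._* D) (sym (ℤ.*-distribʳ-+ D i j))) (ℤ.*-assoc (i ℤ.+ j) D D)

/-≃ : ∀ i j c d → i ℤ.* + suc d ≡ j ℤ.* + suc c → i / suc c ≡ j / suc d
/-≃ i j c d eq = fromℚᵘ-cong {ℚᵘ.mkℚᵘ i c} {ℚᵘ.mkℚᵘ j d} (ℚᵘ.*≡* eq)

/-< : ∀ i j c d → (i / suc c < j / suc d) ⇔ (i ℤ.* + suc d ℤ.< j ℤ.* + suc c)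
/-< i j c d = mk⇔
  (λ lt → ℚᵘ.drop-*<* (ℚᵘ.<-respˡ-≃ (toℚᵘ-/ i c) (ℚᵘ.<-respʳ-≃ (toℚᵘ-/ j d) (toℚᵘ-mono-< lt))))
  (λ lt → toℚᵘ-cancel-< (ℚᵘ.<-respˡ-≃ (ℚᵘ.≃-sym (toℚᵘ-/ i c))
            (ℚᵘ.<-respʳ-≃ (ℚᵘ.≃-sym (toℚᵘ-/ j d)) (ℚᵘ.*<* lt))))

·-unit : ∀ k d → k · (1ℤ / suc d) ≡ + k / suc d
·-unit zero    d = /-≃ 0ℤ 0ℤ 0 d refl
·-unit (suc k) d = trans (cong (_+_ (1ℤ / suc d)) (·-unit k d)) (/-+-same 1ℤ (+ k) d)

2^∸1 : ℕ → ℕ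
2^∸1 n = ℕ.pred (2 ℕ.^ n)

1+2^∸1 : ∀ n → suc (2^∸1 n) ≡ 2 ℕ.^ n
1+2^∸1 n = ℕ.suc-pred (2 ℕ.^ n) {{ℕ.m^n≢0 2 n}}

2^-≡/ : ∀ n → 2^- n ≡ 1ℤ / suc (2^∸1 n)
2^-≡/ n = /-cong {p₁ = 1ℤ} {q₁ = 2 ℕ.^ n} {{ℕ.m^n≢0 2 n}} refl (sym (1+2^∸1 n))

·2^-≡/ : ∀ k n → k · 2^- n ≡ + k / suc (2^∸1 n)
·2^-≡/ k n = trans (cong (k ·_) (2^-≡/ n)) (·-unit k (2^∸1 n))

2^-half : ∀ n → 2^- suc n + 2^- suc n ≡ 2^- n
2^-half n = begin
  2^- suc n + 2^- suc n     ≡⟨ cong (_+_ (2^- suc n)) (+-identityʳ (2^- suc n)) ⟨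
  2 · 2^- suc n             ≡⟨ ·2^-≡/ 2 (suc n) ⟩
  + 2 / suc (2^∸1 (suc n))  ≡⟨ /-≃ (+ 2) 1ℤ (2^∸1 (suc n)) (2^∸1 n) eq ⟩
  1ℤ / suc (2^∸1 n)         ≡⟨ 2^-≡/ n ⟨
  2^- n                     ∎
  where
  open ≡-Reasoning
  eq : + 2 ℤ.* + suc (2^∸1 n) ≡ 1ℤ ℤ.* + suc (2^∸1 (suc n))
  eq = trans (sym (ℤ.pos-* 2 (suc (2^∸1 n)))) (trans (cong +_ (trans (cong (2 ℕ.*_) (1+2^∸1 n))
         (sym (1+2^∸1 (suc n))))) (sym (ℤ.*-identityˡ _)))

2^-pos : ∀ n → 0ℚ < 2^- n
2^-pos n = subst (0ℚ <_) (sym (2^-≡/ n)) (Equivalence.from (/-< 0ℤ 1ℤ 0 (2^∸1 n))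
  (ℤ.+<+ (s≤s z≤n)))

2^-nonneg : ∀ n → 0ℚ ≤ 2^- n
2^-nonneg n = <⇒≤ (2^-pos n)

p≤p+q : ∀ {p q} → 0ℚ ≤ q → p ≤ p + q
p≤p+q {p} 0≤q = ≤-trans (≤-reflexive (sym (+-identityʳ p))) (+-monoʳ-≤ p 0≤q)

p≤q+p : ∀ {p q} → 0ℚ ≤ q → p ≤ q + p
p≤q+p {p} {q} 0≤q = ≤-trans (p≤p+q 0≤q) (≤-reflexive (+-comm p q))

+-nonneg : ∀ {p q} → 0ℚ ≤ p → 0ℚ ≤ q → 0ℚ ≤ p + q
+-nonneg 0≤p 0≤q = ≤-trans 0≤p (p≤p+q 0≤q)

+-cancelʳ-≤ : ∀ {p q} r → p + r ≤ q + r → p ≤ q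
+-cancelʳ-≤ {p} {q} r le = subst₂ _≤_ (lem p r) (lem q r) (+-monoˡ-≤ (- r) le)
  where
  lem : ∀ p r → p + r + - r ≡ p
  lem = solve 2 (λ p r → p :+ r :+ :- r := p) refl where open +-*-Solver

·-nonneg : ∀ k {p} → 0ℚ ≤ p → 0ℚ ≤ k · p
·-nonneg zero    0≤p = ≤-refl
·-nonneg (suc k) 0≤p = +-nonneg 0≤p (·-nonneg k 0≤p)

·-monoˡ-≤ : ∀ {j k p} → 0ℚ ≤ p → j ℕ.≤ k → j · p ≤ k · p
·-monoˡ-≤ {k = k} 0≤p z≤n   = ·-nonneg k 0≤p
·-monoˡ-≤ {p = p} 0≤p (s≤s le) = +-monoʳ-≤ p (·-monoˡ-≤ 0≤p le)

2^-suc-≤ : ∀ n → 2^- suc n ≤ 2^- n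
2^-suc-≤ n = ≤-trans (p≤p+q (2^-nonneg (suc n))) (≤-reflexive (2^-half n))

2^-antitone : ∀ {m n} → m ℕ.≤ n → 2^- n ≤ 2^- m
2^-antitone {m} {n} m≤n = subst (λ k → 2^- k ≤ 2^- m) (ℕ.m∸n+n≡m m≤n) (go (n ℕ.∸ m))
  where
  go : ∀ k → 2^- (k ℕ.+ m) ≤ 2^- m
  go zero    = ≤-refl
  go (suc k) = ≤-trans (2^-suc-≤ (k ℕ.+ m)) (go k)

2^·2^- : ∀ d t → 2 ℕ.^ t · 2^- (d ℕ.+ t) ≡ 2^- d
2^·2^- d zero    = trans (+-identityʳ _) (cong 2^-_ (ℕ.+-identityʳ d))
2^·2^- d (suc t) = begin
  (2^t ℕ.+ (2^t ℕ.+ 0)) · p  ≡⟨ cong (λ k → (2^t ℕ.+ k) · p) (ℕ.+-identityʳ 2^t) ⟩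
  (2^t ℕ.+ 2^t) · p          ≡⟨ ·-homo-+ p 2^t 2^t ⟩
  2^t · p + 2^t · p          ≡⟨ ·-distrib-+ p p 2^t ⟨
  2^t · (p + p)              ≡⟨ cong (λ n → 2^t · (2^- n + 2^- n)) (ℕ.+-suc d t) ⟩
  2^t · (2^- suc (d ℕ.+ t) + 2^- suc (d ℕ.+ t)) ≡⟨ cong (2^t ·_) (2^-half (d ℕ.+ t)) ⟩
  2^t · 2^- (d ℕ.+ t)        ≡⟨ 2^·2^- d t ⟩
  2^- d                      ∎
  where
  open ≡-Reasoning
  2^t = 2 ℕ.^ t
  p = 2^- (d ℕ.+ suc t)

rescale : ∀ k d t → (k ℕ.* 2 ℕ.^ t) · 2^- (d ℕ.+ t) ≡ k · 2^- d
rescale k d t = trans (sym (·-assoc (2^- (d ℕ.+ t)) k (2 ℕ.^ t))) (cong (k ·_) (2^·2^- d t))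

add-dyadic : ∀ a d b e → a · 2^- d + b · 2^- e ≡ (a ℕ.* 2 ℕ.^ e ℕ.+ b ℕ.* 2 ℕ.^ d) · 2^- (d ℕ.+ e)
add-dyadic a d b e = sym (trans (·-homo-+ (2^- (d ℕ.+ e)) (a ℕ.* 2 ℕ.^ e) (b ℕ.* 2 ℕ.^ d))
  (cong₂ _+_ (rescale a d e) (trans (cong (λ n → (b ℕ.* 2 ℕ.^ d) · 2^- n) (ℕ.+-comm d e)) (rescale b e d))))

n<2^n : ∀ n → n ℕ.< 2 ℕ.^ n
n<2^n zero    = s≤s z≤n
n<2^n (suc n) = ℕ.≤-trans (ℕ.+-mono-≤ (s≤s z≤n) (n<2^n n))
  (ℕ.≤-trans (ℕ.+-monoˡ-≤ (2 ℕ.^ n) (ℕ.≤-trans (s≤s z≤n) (n<2^n n)))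
             (ℕ.+-monoʳ-≤ (2 ℕ.^ n) (ℕ.m≤m+n (2 ℕ.^ n) 0)))

archimedean : ∀ ε → 0ℚ < ε → ∃ λ n → 2^- n < ε
archimedean ε@(mkℚ (+ zero) d _)     (*<* (ℤ.+<+ ()))
archimedean ε@(mkℚ (+ suc a) d _)    _ = n , subst₂ _<_ (sym (2^-≡/ n)) (fromℚᵘ-toℚᵘ ε)
  (Equivalence.from (/-< 1ℤ (+ suc a) (2^∸1 n) d) (subst₂ ℤ._<_ (sym (ℤ.*-identityˡ (+ n)))
     (trans (cong (λ m → + (suc a ℕ.* m)) (sym (1+2^∸1 n))) (ℤ.pos-* (suc a) (suc (2^∸1 n))))
     (ℤ.+<+ (ℕ.<-≤-trans (n<2^n n) (ℕ.m≤m+n (2 ℕ.^ n) _)))))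
  where n = suc d
archimedean (mkℚ ℤ.-[1+ _ ] d _) (*<* ())

-- Cross-multiplication with the subtracted b moved to the right: the comparison becomes one of
-- natural numbers and can be tested by a recursive function.
⊖/-< : ∀ a b c k d →
       ((a ⊖ b) / suc c < k · 2^- d) ⇔ (a ℕ.* 2 ℕ.^ d ℕ.< k ℕ.* suc c ℕ.+ b ℕ.* 2 ℕ.^ d)
⊖/-< a b c k d = mk⇔
  (λ lt → ℤ.drop‿+<+ (subst₂ ℤ._<_ lhs rhs
     (ℤ.+-monoˡ-< B (Equivalence.to (/-< (a ⊖ b) (+ k) c (2^∸1 d)) (subst ((a ⊖ b) / suc c <_) (·2^-≡/ k d) lt)))))
  (λ lt → subst ((a ⊖ b) / suc c <_) (sym (·2^-≡/ k d))
     (Equivalence.from (/-< (a ⊖ b) (+ k) c (2^∸1 d))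
       (ℤ.≰⇒> λ le → ℤ.<⇒≱ (subst₂ ℤ._<_ (sym lhs) (sym rhs) (ℤ.+<+ lt)) (ℤ.+-monoˡ-≤ B le))))
  where
  open ≡-Reasoning
  D = 2 ℕ.^ d
  B = + (b ℕ.* D)
  lhs : (a ⊖ b) ℤ.* + suc (2^∸1 d) ℤ.+ B ≡ + (a ℕ.* D)
  lhs = begin
    (a ⊖ b) ℤ.* + suc (2^∸1 d) ℤ.+ B  ≡⟨ cong (λ m → (a ⊖ b) ℤ.* + m ℤ.+ B) (1+2^∸1 d) ⟩
    (a ⊖ b) ℤ.* + D ℤ.+ B             ≡⟨ cong (λ i → (a ⊖ b) ℤ.* + D ℤ.+ i) (ℤ.pos-* b D) ⟩
    (a ⊖ b) ℤ.* + D ℤ.+ + b ℤ.* + D   ≡⟨ ℤ.*-distribʳ-+ (+ D) (a ⊖ b) (+ b) ⟨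
    (a ⊖ b ℤ.+ + b) ℤ.* + D           ≡⟨ cong (ℤ._* + D) cancel ⟩
    + a ℤ.* + D                       ≡⟨ ℤ.pos-* a D ⟨
    + (a ℕ.* D)                       ∎
    where
    cancel : a ⊖ b ℤ.+ + b ≡ + a
    cancel = trans (cong (ℤ._+ + b) (sym (ℤ.m-n≡m⊖n a b))) (trans (ℤ.+-assoc (+ a) (ℤ.- + b) (+ b))
      (trans (cong (ℤ._+_ (+ a)) (ℤ.+-inverseˡ (+ b))) (ℤ.+-identityʳ (+ a))))
  rhs : + k ℤ.* + suc c ℤ.+ B ≡ + (k ℕ.* suc c ℕ.+ b ℕ.* D)
  rhs = cong (ℤ._+ B) (sym (ℤ.pos-* k (suc c)))

-- The stations of one class

-- A station holds `pieces` pieces of size 2^-exponent and the number of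
-- sources, 0 or 1, that it has not released yet.
record Entry : Set where
  constructor entry
  field sources pieces exponent : ℕ

open Entry

ite-≢0 : ∀ m {k l} → ite m 0 k ≡ suc l → m ≡ 0 × k ≡ suc l
ite-≢0 zero eq = refl , eq

ite-≡0 : ∀ m {k} → ite m 0 k ≡ 0 → m ≢ 0 ⊎ k ≡ 0
ite-≡0 zero    eq = inj₂ eq
ite-≡0 (suc m) eq = inj₁ λ ()

module Stage (n t u : ℕ) where

  -- Convergence is the value 0 of `τ`, so the last argument of `ite` is the converged case, here
  -- and in `due`.
  held : ℕ → ℕ
  held i = ite (τ i n t) 0 (τ i u t)

  due : ℕ → ℕ → ℕ
  due i s = ite (τ i n t) 0 s

  -- The second component is 0 if nothing happened, 1 if something happened
  -- but no piece was emitted downwards, and 2 + d if a piece of size 2^-d was.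
  receive : ∀ {k} → ℕ → ℕ → Vec Entry k × ℕ → Vec Entry (suc k) × ℕ
  receive s d (es , suc (suc d′)) = entry s (2 ^ t) (d′ ℕ.+ t) ∷ es , 1
  receive s d (es , m)            = entry s 0 d ∷ es , m

  visit : ∀ {k} → ℕ → Entry → Vec Entry k → ℕ → ℕ → Vec Entry k × ℕ → Vec Entry (suc k) × ℕ
  visit i (entry s (suc r) d) es zero    _       _   = entry s r d ∷ es , 2 ℕ.+ d
  visit i (entry s (suc r) d) es (suc _) _       _   = entry s (suc r) d ∷ es , 0
  visit i (entry s zero    d) es _       (suc _) _   = entry (pred s) (2 ^ t) (n ℕ.+ i ℕ.+ t) ∷ es , 1
  visit i (entry s zero    d) es _       zero    res = receive s d res

  -- At most one event per stage: the lowest station that holds a piece or has a source due decides,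
  -- and a blocked station stops everything above it. A piece emitted from above is caught by the
  -- station directly below and cut up there; only station 0 emits to the outside.
  scan : ∀ {k} → ℕ → Vec Entry k → Vec Entry k × ℕ
  scan i []       = [] , 0
  scan i (e ∷ es) = visit i e es (held i) (due i (sources e)) (scan (suc i) es)

  data Scan : ∀ {k} → ℕ → Vec Entry k → Vec Entry k → ℕ → Set where
    end   : ∀ {i} → Scan i [] [] 0
    pass  : ∀ {i k s r d} {es : Vec Entry k} → τ i n t ≢ 0 ⊎ τ i u t ≡ 0 →
            Scan i (entry s (suc r) d ∷ es) (entry s r d ∷ es) (2 ℕ.+ d)
    hold  : ∀ {i k s r d} {es : Vec Entry k} → τ i n t ≡ 0 → τ i u t ≢ 0 →
            Scan i (entry s (suc r) d ∷ es) (entry s (suc r) d ∷ es) 0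
    issue : ∀ {i k s d} {es : Vec Entry k} → τ i n t ≡ 0 →
            Scan i (entry (suc s) 0 d ∷ es) (entry s (2 ^ t) (n ℕ.+ i ℕ.+ t) ∷ es) 1
    skip  : ∀ {i k s d m} {es es′ : Vec Entry k} → τ i n t ≢ 0 ⊎ s ≡ 0 → m ℕ.≤ 1 →
            Scan (suc i) es es′ m → Scan i (entry s 0 d ∷ es) (entry s 0 d ∷ es′) m
    recv  : ∀ {i k s d d′} {es es′ : Vec Entry k} → τ i n t ≢ 0 ⊎ s ≡ 0 →
            Scan (suc i) es es′ (2 ℕ.+ d′) →
            Scan i (entry s 0 d ∷ es) (entry s (2 ^ t) (d′ ℕ.+ t) ∷ es′) 1

  scan-view : ∀ {k} i (es : Vec Entry k) → Scan i es (proj₁ (scan i es)) (proj₂ (scan i es))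
  scan-view i [] = end
  scan-view i (entry s (suc r) d ∷ es) with ite (τ i n t) 0 (τ i u t) in eq
  ... | zero  = pass (ite-≡0 (τ i n t) eq)
  ... | suc _ = let p , q = ite-≢0 (τ i n t) eq in hold p λ e → contradiction (trans (sym q) e) λ ()
  scan-view i (entry s zero d ∷ es) with ite (τ i n t) 0 s in eq
  ... | suc _ with ite-≢0 (τ i n t) {s} eq
  ...   | p , refl = issue p
  scan-view i (entry s zero d ∷ es) | zero with scan (suc i) es | scan-view (suc i) es
  ...   | es′ , zero         | v = skip (ite-≡0 (τ i n t) eq) z≤n v
  ...   | es′ , suc zero     | v = skip (ite-≡0 (τ i n t) eq) (s≤s z≤n) v
  ...   | es′ , suc (suc d′) | v = recv (ite-≡0 (τ i n t) eq) v

-- Conservation of weight in one stage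

out : ℕ → ℚ
out (suc (suc d)) = 2^- d
out _             = 0ℚ

out-≤1 : ∀ {m} → m ℕ.≤ 1 → out m ≡ 0ℚ
out-≤1 z≤n       = refl
out-≤1 (s≤s z≤n) = refl

at : ∀ {k} → ℕ → Vec Entry k → Entry
at _       []       = entry 0 0 0
at zero    (e ∷ es) = e
at (suc j) (e ∷ es) = at j es

Empty : ∀ {k} → ℕ → Vec Entry k → Set
Empty j es = ∀ i → i ℕ.< j → pieces (at i es) ≡ 0

module Weight (n : ℕ) where

  weight : ℕ → Entry → ℚ
  weight i (entry s r d) = s · 2^- (n ℕ.+ i) + r · 2^- d

  -- j counts stations; the head of the list is station i.
  V : ∀ {k} → ℕ → ℕ → Vec Entry k → ℚ
  V zero    i es       = 0ℚ
  V (suc j) i []       = 0ℚ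
  V (suc j) i (e ∷ es) = weight i e + V j (suc i) es

  weight-nonneg : ∀ i e → 0ℚ ≤ weight i e
  weight-nonneg i (entry s r d) = +-nonneg (·-nonneg s (2^-nonneg (n ℕ.+ i))) (·-nonneg r (2^-nonneg d))

  V-nonneg : ∀ {k} j i (es : Vec Entry k) → 0ℚ ≤ V j i es
  V-nonneg zero    i es       = ≤-refl
  V-nonneg (suc j) i []       = ≤-refl
  V-nonneg (suc j) i (e ∷ es) = +-nonneg (weight-nonneg i e) (V-nonneg j (suc i) es)

module Flow (n t u : ℕ) where
  open Stage n t u
  open Weight n

  -- The one event that changes the balance of the first j stations and the outside: station j hands
  -- down a piece. The scan reaches station j only past empty stations, hence `below-empty`;
  -- `active` ensures that the stage is recorded as that of the last move.
  record Transfer {k} (i j : ℕ) (es es′ : Vec Entry k) (m : ℕ) : Set where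
    field
      below-empty : Empty j es
      nonempty    : pieces (at j es) ≢ 0
      allowed     : τ (i ℕ.+ j) n t ≢ 0 ⊎ τ (i ℕ.+ j) u t ≡ 0
      active      : m ≢ 0
      gain        : out m + V j i es′ ≡ V j i es + 2^- exponent (at j es)

  exchange : ∀ p a b → p + (a + b) ≡ a + (p + b)
  exchange = solve 3 (λ p a b → p :+ (a :+ b) := a :+ (p :+ b)) refl where open +-*-Solver

  absorb : ∀ a d c → 0ℚ + (a + 2 ^ t · 2^- (d ℕ.+ t) + c) ≡ (a + 0ℚ) + (2^- d + c)
  absorb a d c = trans (cong (λ b → 0ℚ + (a + b + c)) (2^·2^- d t))
    (solve 3 (λ a p c → con 0ℚ :+ (a :+ p :+ c) := (a :+ con 0ℚ) :+ (p :+ c)) refl a (2^- d) c)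
    where open +-*-Solver

  empty-∷ : ∀ {k j s d} {es : Vec Entry k} → Empty j es → Empty (suc j) (entry s 0 d ∷ es)
  empty-∷ empty zero    _         = refl
  empty-∷ empty (suc l) (s≤s l<j) = empty l l<j

  -- Cutting preserves weight, since 2^t pieces of size 2^-(d+t) make up 2^-d, and an unreleased
  -- source already counts with the weight that it releases. So only a crossing of the boundary
  -- below station j matters.
  flow : ∀ {k i m} {es es′ : Vec Entry k} → Scan i es es′ m → ∀ j →
         (out m + V j i es′ ≡ V j i es) ⊎ Transfer i j es es′ m
  flow end zero                = inj₁ refl
  flow {i = i} (pass {d = d} ok) zero = inj₂ record
    { below-empty = λ _ ()
    ; nonempty    = λ ()
    ; allowed     = subst (λ j → τ j n t ≢ 0 ⊎ τ j u t ≡ 0) (sym (ℕ.+-identityʳ i)) ok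
    ; active      = λ ()
    ; gain        = +-comm (2^- d) 0ℚ
    }
  flow (hold _ _) zero         = inj₁ refl
  flow (issue _) zero          = inj₁ refl
  flow (skip _ m≤1 _) zero     = inj₁ (trans (+-identityʳ _) (out-≤1 m≤1))
  flow (recv _ _) zero         = inj₁ refl
  flow end (suc j)             = inj₁ refl
  flow {i = i} (pass {s = s} {r} {d} {es} _) (suc j) = inj₁
    (solve 4 (λ p a b c → p :+ (a :+ b :+ c) := a :+ (p :+ b) :+ c) refl
      (2^- d) (s · 2^- (n ℕ.+ i)) (r · 2^- d) (V j (suc i) es))
    where open +-*-Solver
  flow (hold _ _) (suc j)      = inj₁ (+-identityˡ _)
  flow {i = i} (issue {s = s} {d} {es} _) (suc j) = inj₁ (begin
    0ℚ + (a + 2 ^ t · 2^- (n ℕ.+ i ℕ.+ t) + c) ≡⟨ cong (λ b → 0ℚ + (a + b + c)) (2^·2^- (n ℕ.+ i) t) ⟩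
    0ℚ + (a + w + c)                         ≡⟨ solve 3 (λ a w c → con 0ℚ :+ (a :+ w :+ c) := w :+ a :+ con 0ℚ :+ c) refl a w c ⟩
    w + a + 0ℚ + c                           ∎)
    where
    open +-*-Solver
    open ≡-Reasoning
    w = 2^- (n ℕ.+ i)
    a = s · w
    c = V j (suc i) es
  flow {i = i} (skip {s = s} {m = m} {es} {es′} _ m≤1 v) (suc j) with flow v j
  ... | inj₁ eq = inj₁ (trans (exchange (out m) a (V j (suc i) es′)) (cong (_+_ a) eq))
    where a = s · 2^- (n ℕ.+ i) + 0ℚ
  ... | inj₂ tr = inj₂ record
    { Transfer tr
    ; below-empty = empty-∷ (Transfer.below-empty tr)
    ; allowed     = subst (λ j → τ j n t ≢ 0 ⊎ τ j u t ≡ 0) (sym (ℕ.+-suc i j)) (Transfer.allowed tr)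
    ; gain        = trans (exchange (out m) a (V j (suc i) es′)) (trans (cong (_+_ a) (Transfer.gain tr))
                      (sym (+-assoc a (V j (suc i) es) _)))
    }
    where a = s · 2^- (n ℕ.+ i) + 0ℚ
  flow {i = i} (recv {s = s} {d′ = d′} {es} {es′} _ v) (suc j) with flow v j
  ... | inj₁ eq = inj₁ (trans (absorb a d′ (V j (suc i) es′)) (cong (_+_ (a + 0ℚ)) eq))
    where a = s · 2^- (n ℕ.+ i)
  ... | inj₂ tr = inj₂ record
    { Transfer tr
    ; below-empty = empty-∷ (Transfer.below-empty tr)
    ; allowed     = subst (λ j → τ j n t ≢ 0 ⊎ τ j u t ≡ 0) (sym (ℕ.+-suc i j)) (Transfer.allowed tr)
    ; active      = λ ()
    ; gain        = trans (absorb a d′ (V j (suc i) es′))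
                      (trans (cong (_+_ (a + 0ℚ)) (Transfer.gain tr)) (sym (+-assoc (a + 0ℚ) (V j (suc i) es) _)))
    }
    where a = s · 2^- (n ℕ.+ i)

-- Sources and pieces under one scan

Fine : ℕ → Entry → Set
Fine M e = pieces e ≡ 0 ⊎ M ℕ.≤ exponent e

module ScanProperties (n t u : ℕ) where
  open Stage n t u

  -- Pieces created at stage t get an exponent of the form d + t, so new pieces are fine as soon as
  -- t ≥ M; old pieces keep their exponent.
  fine-step : ∀ {k i m M} {es es′ : Vec Entry k} → Scan i es es′ m → M ℕ.≤ t →
              ∀ j → Fine M (at j es) → Fine M (at j es′)
  fine-step end M≤t j fine = fine
  fine-step (pass _) M≤t zero (inj₂ M≤d) = inj₂ M≤d
  fine-step (pass _) M≤t (suc j) fine = fine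
  fine-step (hold _ _) M≤t j fine = fine
  fine-step (issue _) M≤t zero fine = inj₂ (ℕ.m≤n⇒m≤o+n _ M≤t)
  fine-step (issue _) M≤t (suc j) fine = fine
  fine-step (skip _ _ v) M≤t zero fine = inj₁ refl
  fine-step (skip _ _ v) M≤t (suc j) fine = fine-step v M≤t j fine
  fine-step (recv {d′ = d′} _ v) M≤t zero fine = inj₂ (ℕ.m≤n⇒m≤o+n d′ M≤t)
  fine-step (recv _ v) M≤t (suc j) fine = fine-step v M≤t j fine

  sources-step : ∀ {k i m} {es es′ : Vec Entry k} → Scan i es es′ m →
                 ∀ j → sources (at j es′) ℕ.≤ sources (at j es)
  sources-step end j = ℕ.≤-refl
  sources-step (pass _) zero = ℕ.≤-refl
  sources-step (pass _) (suc j) = ℕ.≤-refl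
  sources-step (hold _ _) j = ℕ.≤-refl
  sources-step (issue _) zero = ℕ.n≤1+n _
  sources-step (issue _) (suc j) = ℕ.≤-refl
  sources-step (skip _ _ v) zero = ℕ.≤-refl
  sources-step (skip _ _ v) (suc j) = sources-step v j
  sources-step (recv _ v) zero = ℕ.≤-refl
  sources-step (recv _ v) (suc j) = sources-step v j

  sources-kept : ∀ {k i m} {es es′ : Vec Entry k} → Scan i es es′ m →
                 ∀ j → τ (i ℕ.+ j) n t ≢ 0 → sources (at j es′) ≡ sources (at j es)
  sources-kept end j ≢0 = refl
  sources-kept (pass _) zero ≢0 = refl
  sources-kept (pass _) (suc j) ≢0 = refl
  sources-kept (hold _ _) j ≢0 = refl
  sources-kept {i = i} (issue τ≡0) zero ≢0 = ⊥-elim (≢0 (subst (λ j → τ j n t ≡ 0) (sym (ℕ.+-identityʳ i)) τ≡0))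
  sources-kept (issue _) (suc j) ≢0 = refl
  sources-kept (skip _ _ v) zero ≢0 = refl
  sources-kept {i = i} (skip _ _ v) (suc j) ≢0 = sources-kept v j (subst (λ j → τ j n t ≢ 0) (ℕ.+-suc i j) ≢0)
  sources-kept (recv _ v) zero ≢0 = refl
  sources-kept {i = i} (recv _ v) (suc j) ≢0 = sources-kept v j (subst (λ j → τ j n t ≢ 0) (ℕ.+-suc i j) ≢0)

  -- Only a blocked station can make a scan idle while pieces remain, because the lowest nonempty
  -- station would otherwise emit.
  idle-empty : ∀ {k i} {es es′ : Vec Entry k} → Scan i es es′ 0 →
               ∀ j → (∀ l → l ℕ.< j → τ (i ℕ.+ l) n t ≢ 0 ⊎ τ (i ℕ.+ l) u t ≡ 0) → Empty j es
  idle-empty end j ok l l<j = refl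
  idle-empty {i = i} (hold τ≡0 τ≢0) (suc j) ok l l<j with ok 0 (s≤s z≤n)
  ... | inj₁ ≢0 = ⊥-elim (≢0 (subst (λ j → τ j n t ≡ 0) (sym (ℕ.+-identityʳ i)) τ≡0))
  ... | inj₂ ≡0 = ⊥-elim (τ≢0 (subst (λ j → τ j u t ≡ 0) (ℕ.+-identityʳ i) ≡0))
  idle-empty (skip _ _ v) j ok zero l<j = refl
  idle-empty {i = i} (skip _ _ v) (suc j) ok (suc l) (s≤s l<j) = idle-empty v j
    (λ l l<j → subst (λ j → τ j n t ≢ 0 ⊎ τ j u t ≡ 0) (ℕ.+-suc i l) (ok (suc l) (s≤s l<j))) l l<j

  idle-issued : ∀ {k i} {es es′ : Vec Entry k} → Scan i es es′ 0 →
                ∀ j → Empty (suc j) es → τ (i ℕ.+ j) n t ≡ 0 → sources (at j es) ≡ 0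
  idle-issued end j empty τ≡0 = refl
  idle-issued (hold _ _) j empty τ≡0 = contradiction (empty 0 (s≤s z≤n)) λ ()
  idle-issued (skip (inj₂ eq) _ v) zero empty τ≡0 = eq
  idle-issued {i = i} (skip (inj₁ ≢0) _ v) zero empty τ≡0 = ⊥-elim (≢0 (subst (λ j → τ j n t ≡ 0) (ℕ.+-identityʳ i) τ≡0))
  idle-issued {i = i} (skip _ _ v) (suc j) empty τ≡0 =
    idle-issued v j (λ l l<j → empty (suc l) (s≤s l<j)) (subst (λ j → τ j n t ≡ 0) (ℕ.+-suc i j) τ≡0)

-- Lexicographic in (sources, pieces), the topmost station being the most
-- significant: a station that loses a piece refills only stations below it.
data _<ₑ_ : Entry → Entry → Set where
  fewer-sources : ∀ {s s′ r r′ d d′} → s′ ℕ.< s → entry s′ r′ d′ <ₑ entry s r d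
  fewer-pieces  : ∀ {s r r′ d d′} → r′ ℕ.< r → entry s r′ d′ <ₑ entry s r d

<ₑ-wellFounded : WellFounded _<ₑ_
<ₑ-wellFounded (entry s r d) = go (<-wellFounded s) (<-wellFounded r)
  where
  go : ∀ {s r d} → Acc ℕ._<_ s → Acc ℕ._<_ r → Acc _<ₑ_ (entry s r d)
  smaller : ∀ {s r d e} → Acc ℕ._<_ s → Acc ℕ._<_ r → e <ₑ entry s r d → Acc _<ₑ_ e
  go as ar = acc (smaller as ar)
  smaller (acc rs) ar (fewer-sources {r′ = r′} lt) = go (rs lt) (<-wellFounded r′)
  smaller as (acc rr) (fewer-pieces lt)            = go as (rr lt)

data _≺_ : ∀ {k} → Vec Entry k → Vec Entry k → Set where
  above : ∀ {k e e′} {es es′ : Vec Entry k} → es′ ≺ es → (e′ ∷ es′) ≺ (e ∷ es)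
  here  : ∀ {k e e′} {es : Vec Entry k} → e′ <ₑ e → (e′ ∷ es) ≺ (e ∷ es)

≺-wellFounded : ∀ {k} → WellFounded (_≺_ {k})
≺-wellFounded []       = acc λ ()
≺-wellFounded (e ∷ es) = go (≺-wellFounded es) (<ₑ-wellFounded e)
  where
  go : ∀ {k e} {es : Vec Entry k} → Acc _≺_ es → Acc _<ₑ_ e → Acc _≺_ (e ∷ es)
  smaller : ∀ {k e} {es : Vec Entry k} {es′} → Acc _≺_ es → Acc _<ₑ_ e → es′ ≺ (e ∷ es) → Acc _≺_ es′
  go as ae = acc (smaller as ae)
  smaller (acc rs) ae (above {e′ = e′} p) = go (rs p) (<ₑ-wellFounded e′)
  smaller as (acc re) (here p)            = go as (re p)

scan-decreases : ∀ {n t u k i m} {es es′ : Vec Entry k} → Stage.Scan n t u i es es′ m →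
                 (m ≡ 0 × es′ ≡ es) ⊎ (m ≢ 0 × es′ ≺ es)
scan-decreases Stage.end = inj₁ (refl , refl)
scan-decreases (Stage.pass _) = inj₂ ((λ ()) , here (fewer-pieces ℕ.≤-refl))
scan-decreases (Stage.hold _ _) = inj₁ (refl , refl)
scan-decreases (Stage.issue _) = inj₂ ((λ ()) , here (fewer-sources ℕ.≤-refl))
scan-decreases (Stage.skip _ _ v) with scan-decreases v
... | inj₁ (eq , refl) = inj₁ (eq , refl)
... | inj₂ (≢0 , p)    = inj₂ (≢0 , above p)
scan-decreases (Stage.recv _ v) with scan-decreases v
... | inj₁ (() , _)
... | inj₂ (_ , p) = inj₂ ((λ ()) , above p)

-- The run of one class

record State (n : ℕ) : Set where
  constructor state
  field
    last     : ℕ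
    stations : Vec Entry n
    num      : ℕ
    denom    : ℕ

-- The amount paid is a · 2^-b, so b is an exponent. It is enlarged by d rather than to a maximum:
-- the fraction is never reduced and the update is plain arithmetic.
deposit : ℕ → ℕ → ℕ → ℕ × ℕ
deposit (suc (suc d)) a b = a ℕ.* 2 ^ d ℕ.+ 1 ℕ.* 2 ^ b , b ℕ.+ d
deposit _             a b = a , b

advance : ∀ {n} → ℕ → State n → State n
advance {n} t (state u es a b) =
  let es′ , m = Stage.scan n t u 0 es
      a′ , b′ = deposit m a b
  in state (ite m t u) es′ a′ b′

class : ∀ n → ℕ → State n
class n zero    = state 0 (replicate n (entry 1 0 0)) 0 0
class n (suc t) = advance t (class n t)

deposit-out : ∀ m a b → proj₁ (deposit m a b) · 2^- proj₂ (deposit m a b) ≡ a · 2^- b + out m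
deposit-out 0 a b = sym (+-identityʳ _)
deposit-out 1 a b = sym (+-identityʳ _)
deposit-out (suc (suc d)) a b = trans (sym (add-dyadic a b 1 d)) (cong (_+_ (a · 2^- b)) (+-identityʳ (2^- d)))

out-nonneg : ∀ m → 0ℚ ≤ out m
out-nonneg 0 = ≤-refl
out-nonneg 1 = ≤-refl
out-nonneg (suc (suc d)) = 2^-nonneg d

ite-cases : ∀ m {t u : ℕ} → (m ≡ 0 × ite m t u ≡ u) ⊎ (m ≢ 0 × ite m t u ≡ t)
ite-cases zero    = inj₁ (refl , refl)
ite-cases (suc m) = inj₂ ((λ ()) , refl)

module _ (n : ℕ) where
  open State

  abstract
    stationsAt : ℕ → Vec Entry n
    stationsAt t = stations (class n t)

    lastAt : ℕ → ℕ
    lastAt t = last (class n t)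

    signal : ℕ → ℕ
    signal t = proj₂ (Stage.scan n t (lastAt t) 0 (stationsAt t))

    paid : ℕ → ℚ
    paid t = num (class n t) · 2^- denom (class n t)

    stationsAt-≡ : ∀ t → stationsAt t ≡ stations (class n t)
    stationsAt-≡ t = refl

    paid-≡ : ∀ t → paid t ≡ num (class n t) · 2^- denom (class n t)
    paid-≡ t = refl

    scanned : ∀ t → Stage.Scan n t (lastAt t) 0 (stationsAt t) (stationsAt (suc t)) (signal t)
    scanned t = Stage.scan-view n t (lastAt t) 0 (stationsAt t)

    paid-suc : ∀ t → paid (suc t) ≡ paid t + out (signal t)
    paid-suc t = deposit-out (signal t) (num (class n t)) (denom (class n t))

    lastAt-suc : ∀ t → (signal t ≡ 0 × lastAt (suc t) ≡ lastAt t) ⊎ (signal t ≢ 0 × lastAt (suc t) ≡ t)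
    lastAt-suc t = ite-cases (signal t)

  paid-step : ∀ t → paid t ≤ paid (suc t)
  paid-step t = ≤-trans (p≤p+q (out-nonneg (signal t))) (≤-reflexive (sym (paid-suc t)))

-- Eventual properties

Eventually : (ℕ → Set) → Set
Eventually P = ∃ λ T → ∀ t → T ℕ.≤ t → P t

eventually-× : ∀ {P Q} → Eventually P → Eventually Q → Eventually (λ t → P t × Q t)
eventually-× (T , p) (T′ , q) = T ℕ.+ T′ , λ t le →
  p t (ℕ.≤-trans (ℕ.m≤m+n T T′) le) , q t (ℕ.≤-trans (ℕ.m≤n+m T′ T) le)

eventually-∀ : ∀ {P : ℕ → ℕ → Set} k → (∀ j → j ℕ.< k → Eventually (P j)) →
               Eventually (λ t → ∀ j → j ℕ.< k → P j t)
eventually-∀ zero    ev = 0 , λ _ _ _ ()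
eventually-∀ {P} (suc k) ev =
  let T , p = eventually-× (eventually-∀ k λ j j<k → ev j (ℕ.m<n⇒m<1+n j<k)) (ev k ℕ.≤-refl)
  in T , λ t le j j<1+k → both (p t le) j (ℕ.m≤n⇒m<n∨m≡n (ℕ.s≤s⁻¹ j<1+k))
  where
  both : ∀ {t} → (∀ j → j ℕ.< k → P j t) × P k t → ∀ j → j ℕ.< k ⊎ j ≡ k → P j t
  both (p , q) j (inj₁ j<k)  = p j j<k
  both (p , q) j (inj₂ refl) = q

from-to : ∀ {a t} (P : ℕ → Set) → P a → (∀ t → a ℕ.≤ t → P t → P (suc t)) → a ℕ.≤ t → P t
from-to {a} {t} P base step a≤t = subst P (ℕ.m∸n+n≡m a≤t) (go (t ℕ.∸ a))
  where
  go : ∀ k → P (k ℕ.+ a)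
  go zero    = base
  go (suc k) = step (k ℕ.+ a) (ℕ.m≤n+m a k) (go k)

at-beyond : ∀ {k} (es : Vec Entry k) → at k es ≡ entry 0 0 0
at-beyond []       = refl
at-beyond (e ∷ es) = at-beyond es

at-replicate : ∀ {k j} e → j ℕ.< k → at j (replicate k e) ≡ e
at-replicate {suc k} {zero}  e j<k       = refl
at-replicate {suc k} {suc j} e (s≤s j<k) = at-replicate e j<k

-- The balance of one class over time

module _ (n : ℕ) where
  open Weight n

  weight-mono : ∀ i e e′ → pieces e ≡ 0 → sources e ℕ.≤ sources e′ → weight i e ≤ weight i e′
  weight-mono i (entry s .0 d) (entry s′ r d′) refl s≤s′ =
    +-mono-≤ (·-monoˡ-≤ (2^-nonneg (n ℕ.+ i)) s≤s′) (·-nonneg r (2^-nonneg d′))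

  -- Empty stations weigh only as much as their sources, so a comparison of source counts suffices,
  -- whatever pieces the other configuration holds.
  V-mono : ∀ {k} j i (es es′ : Vec Entry k) → Empty j es →
           (∀ l → l ℕ.< j → sources (at l es) ℕ.≤ sources (at l es′)) → V j i es ≤ V j i es′
  V-mono zero    i es       es′        empty le = ≤-refl
  V-mono (suc j) i []       []         empty le = ≤-refl
  V-mono (suc j) i (e ∷ es) (e′ ∷ es′) empty le =
    +-mono-≤ (weight-mono i e e′ (empty 0 (s≤s z≤n)) (le 0 (s≤s z≤n)))
      (V-mono j (suc i) es es′ (λ l l<j → empty (suc l) (s≤s l<j)) (λ l l<j → le (suc l) (s≤s l<j)))

  V-mono-strict : ∀ {k j h} i (es es′ : Vec Entry k) → h ℕ.< j → Empty j es →
           (∀ l → l ℕ.< j → sources (at l es) ℕ.≤ sources (at l es′)) →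
           sources (at h es) ℕ.< sources (at h es′) → V j i es + 2^- (n ℕ.+ (i ℕ.+ h)) ≤ V j i es′
  V-mono-strict {j = suc j} {h} i [] [] h<j empty le ()
  V-mono-strict {j = suc j} {zero} i (entry s r d ∷ es) (entry s′ r′ d′ ∷ es′) h<j empty le lt
    with empty 0 (s≤s z≤n)
  ... | refl = begin
    s · w + 0ℚ + V j (suc i) es + 2^- (n ℕ.+ (i ℕ.+ 0))
      ≡⟨ cong (λ i′ → s · w + 0ℚ + V j (suc i) es + 2^- (n ℕ.+ i′)) (ℕ.+-identityʳ i) ⟩
    s · w + 0ℚ + V j (suc i) es + w
      ≡⟨ solve 3 (λ a b w → a :+ con 0ℚ :+ b :+ w := w :+ a :+ b) refl (s · w) (V j (suc i) es) w ⟩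
    suc s · w + V j (suc i) es
      ≤⟨ +-mono-≤ (≤-trans (·-monoˡ-≤ (2^-nonneg (n ℕ.+ i)) lt) (p≤p+q (·-nonneg r′ (2^-nonneg d′))))
           (V-mono j (suc i) es es′ (λ l l<j → empty (suc l) (s≤s l<j)) (λ l l<j → le (suc l) (s≤s l<j))) ⟩
    s′ · w + r′ · 2^- d′ + V j (suc i) es′ ∎
    where
    open ≤-Reasoning
    open +-*-Solver
    w = 2^- (n ℕ.+ i)
  V-mono-strict {j = suc j} {suc h} i (e ∷ es) (e′ ∷ es′) (s≤s h<j) empty le lt = begin
    weight i e + V j (suc i) es + 2^- (n ℕ.+ (i ℕ.+ suc h))
      ≡⟨ cong (λ i′ → weight i e + V j (suc i) es + 2^- (n ℕ.+ i′)) (ℕ.+-suc i h) ⟩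
    weight i e + V j (suc i) es + 2^- (n ℕ.+ (suc i ℕ.+ h))
      ≡⟨ +-assoc (weight i e) _ _ ⟩
    weight i e + (V j (suc i) es + 2^- (n ℕ.+ (suc i ℕ.+ h)))
      ≤⟨ +-mono-≤ (weight-mono i e e′ (empty 0 (s≤s z≤n)) (le 0 (s≤s z≤n)))
           (V-mono-strict (suc i) es es′ h<j (λ l l<j → empty (suc l) (s≤s l<j)) (λ l l<j → le (suc l) (s≤s l<j)) lt) ⟩
    weight i e′ + V j (suc i) es′ ∎
    where open ≤-Reasoning

  -- A geometric sum starting at 2^-(n+i); the second summand on the right absorbs the tail in the
  -- induction.
  V-replicate : ∀ k i → V k i (replicate k (entry 1 0 0)) ≤ 2^- (n ℕ.+ i) + 2^- (n ℕ.+ i)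
  V-replicate zero    i = +-nonneg (2^-nonneg (n ℕ.+ i)) (2^-nonneg (n ℕ.+ i))
  V-replicate (suc k) i = begin
    w + 0ℚ + 0ℚ + V k (suc i) (replicate k (entry 1 0 0)) ≡⟨ cong (_+ V k (suc i) _) (trans (+-identityʳ _) (+-identityʳ w)) ⟩
    w + V k (suc i) (replicate k (entry 1 0 0))      ≤⟨ +-monoʳ-≤ w (V-replicate k (suc i)) ⟩
    w + (2^- (n ℕ.+ suc i) + 2^- (n ℕ.+ suc i))      ≡⟨ cong (λ j → w + (2^- j + 2^- j)) (ℕ.+-suc n i) ⟩
    w + (2^- suc (n ℕ.+ i) + 2^- suc (n ℕ.+ i))      ≡⟨ cong (_+_ w) (2^-half (n ℕ.+ i)) ⟩
    w + w                                            ∎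
    where
    open ≤-Reasoning
    w = 2^- (n ℕ.+ i)

  private
    E : ℕ → Vec Entry n
    E = stationsAt n
    X : ℕ → ℚ
    X = paid n
    S : ℕ → ℕ → ℕ
    S j t = sources (at j (E t))

  paid-mono : ∀ {s t} → s ℕ.≤ t → X s ≤ X t
  paid-mono {s} = from-to (λ t → X s ≤ X t) ≤-refl λ t _ le → ≤-trans le (paid-step n t)

  sources-antitone : ∀ j {s t} → s ℕ.≤ t → S j t ℕ.≤ S j s
  sources-antitone j {s} = from-to (λ t → S j t ℕ.≤ S j s) ℕ.≤-refl λ t _ le →
    ℕ.≤-trans (ScanProperties.sources-step n t (lastAt n t) (scanned n t) j) le

  sources-initial : ∀ j t → (∀ t′ → t′ ℕ.< t → τ j n t′ ≢ 0) → S j t ≡ S j 0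
  sources-initial j zero    ≢0 = refl
  sources-initial j (suc t) ≢0 = trans
    (ScanProperties.sources-kept n t (lastAt n t) (scanned n t) j (≢0 t ℕ.≤-refl))
    (sources-initial j t λ t′ t′<t → ≢0 t′ (ℕ.m<n⇒m<1+n t′<t))

  S-0 : ∀ {j} → j ℕ.< n → S j 0 ≡ 1
  S-0 {j} j<n = cong sources (trans (cong (at j) (stationsAt-≡ n 0)) (at-replicate (entry 1 0 0) j<n))

  Flow-at : ∀ j t → (out (signal n t) + V j 0 (E (suc t)) ≡ V j 0 (E t)) ⊎
                    Flow.Transfer n t (lastAt n t) 0 j (E t) (E (suc t)) (signal n t)
  Flow-at j t = Flow.flow n t (lastAt n t) (scanned n t) j

  -- What has been paid out, together with what the first j stations hold,
  -- changes only by transfers out of station j.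
  W : ℕ → ℕ → ℚ
  W j t = X t + V j 0 (E t)

  W-suc : ∀ j t → W j (suc t) ≡ X t + (out (signal n t) + V j 0 (E (suc t)))
  W-suc j t = trans (cong (_+ V j 0 (E (suc t))) (paid-suc n t)) (+-assoc (X t) _ _)

  W-step : ∀ j t → W j t ≤ W j (suc t)
  W-step j t with Flow-at j t
  ... | inj₁ eq = ≤-reflexive (trans (cong (_+_ (X t)) (sym eq)) (sym (W-suc j t)))
  ... | inj₂ tr = ≤-trans (+-monoʳ-≤ (X t) (≤-trans (p≤p+q (2^-nonneg (exponent (at j (E t))))) (≤-reflexive (sym (Flow.Transfer.gain tr)))))
                          (≤-reflexive (sym (W-suc j t)))

  W-mono : ∀ j {s t} → s ℕ.≤ t → W j s ≤ W j t
  W-mono j {s} = from-to (λ t → W j s ≤ W j t) ≤-refl λ t _ le → ≤-trans le (W-step j t)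

  -- There is no station n from which a transfer could come, so the balance of the whole class is
  -- constant.
  W-total : ∀ t → W n t ≡ W n 0
  W-total zero    = refl
  W-total (suc t) with Flow-at n t
  ... | inj₁ eq = trans (trans (W-suc n t) (cong (_+_ (X t)) eq)) (W-total t)
  ... | inj₂ tr = ⊥-elim (Flow.Transfer.nonempty tr (cong pieces (at-beyond (E t))))

  paid-bound : ∀ t → X t ≤ 2^- n + 2^- n
  paid-bound t = begin
    X t                             ≤⟨ p≤p+q (V-nonneg n 0 (E t)) ⟩
    W n t                           ≡⟨ W-total t ⟩
    W n 0                           ≡⟨ cong₂ _+_ (paid-≡ n 0) (cong (V n 0) (stationsAt-≡ n 0)) ⟩
    0ℚ + V n 0 (replicate n (entry 1 0 0)) ≡⟨ +-identityˡ _ ⟩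
    V n 0 (replicate n (entry 1 0 0)) ≤⟨ V-replicate n 0 ⟩
    2^- (n ℕ.+ 0) + 2^- (n ℕ.+ 0)   ≡⟨ cong (λ m → 2^- m + 2^- m) (ℕ.+-identityʳ n) ⟩
    2^- n + 2^- n                   ∎
    where open ≤-Reasoning

  paid-nonneg : ∀ t → 0ℚ ≤ X t
  paid-nonneg t = subst (0ℚ ≤_) (sym (paid-≡ n t)) (·-nonneg (State.num (class n t)) (2^-nonneg (State.denom (class n t))))

inflationary : ∀ {s} → Increasing s → ∀ m → m ℕ.≤ s m
inflationary s-inc zero    = z≤n
inflationary s-inc (suc m) = ℕ.≤-<-trans (inflationary s-inc m) (s-inc ℕ.≤-refl)

-- Quiescence and the final state of a class

module _ (n : ℕ) where
  open Weight n
  open Flow using (module Transfer)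

  unchanged : ∀ {T} k → (∀ j → j ℕ.< k → signal n (j ℕ.+ T) ≡ 0) → stationsAt n (k ℕ.+ T) ≡ stationsAt n T
  unchanged zero    quiet = refl
  unchanged {T} (suc k) quiet with scan-decreases (scanned n (k ℕ.+ T))
  ... | inj₁ (_ , eq) = trans eq (unchanged k λ j j<k → quiet j (ℕ.m<n⇒m<1+n j<k))
  ... | inj₂ (≢0 , _) = ⊥-elim (≢0 (quiet k ℕ.≤-refl))

  lastAt-unchanged : ∀ {T} k → (∀ j → j ℕ.< k → signal n (j ℕ.+ T) ≡ 0) → lastAt n (k ℕ.+ T) ≡ lastAt n T
  lastAt-unchanged zero    quiet = refl
  lastAt-unchanged {T} (suc k) quiet with lastAt-suc n (k ℕ.+ T)
  ... | inj₁ (_ , eq) = trans eq (lastAt-unchanged k λ j j<k → quiet j (ℕ.m<n⇒m<1+n j<k))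
  ... | inj₂ (≢0 , _) = ⊥-elim (≢0 (quiet k ℕ.≤-refl))

  -- Every active stage moves the stations down in the well-founded order `≺`; excluded middle
  -- decides whether another active stage is still to come.
  quiescent : ExcludedMiddle 0ℓ → Eventually λ t → signal n t ≡ 0
  quiescent em = go 0 (≺-wellFounded (stationsAt n 0))
    where
    -- `least` looks for zeros, whereas activity is a nonzero signal; `silent` exchanges the two.
    silent : ℕ → ℕ
    silent m = ite m 0 1
    silent-suc : ∀ m {y} → silent m ≡ suc y → m ≡ 0
    silent-suc zero _ = refl
    silent-0 : ∀ m → silent m ≡ 0 → m ≢ 0
    silent-0 (suc m) _ ()
    go : ∀ T → Acc _≺_ (stationsAt n T) → Eventually λ t → signal n t ≡ 0
    go T (acc rec) with em {∃ λ k → silent (signal n (k ℕ.+ T)) ≡ 0}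
    -- Up to the least active stage the stations are those of stage `T`, so the decrease there is
    -- one relative to `T`.
    ... | yes ex with least (λ k → silent (signal n (k ℕ.+ T))) ex
    ...   | k , before , now with scan-decreases (scanned n (k ℕ.+ T))
    ...     | inj₁ (eq , _) = ⊥-elim (silent-0 (signal n (k ℕ.+ T)) now eq)
    ...     | inj₂ (_ , p)  = go (suc (k ℕ.+ T)) (rec (subst (stationsAt n (suc (k ℕ.+ T)) ≺_)
                (unchanged k λ j j<k → silent-suc (signal n (j ℕ.+ T)) (proj₂ (before j j<k))) p))
    go T (acc rec) | no never = T , λ t T≤t → quiet t T≤t
      where
      quiet : ∀ t → T ℕ.≤ t → signal n t ≡ 0
      quiet t T≤t with signal n t in eq
      ... | zero  = refl
      ... | suc m = ⊥-elim (never (t ℕ.∸ T ,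
              subst (λ t → silent (signal n t) ≡ 0) (sym (ℕ.m∸n+n≡m T≤t)) (cong silent eq)))

  Settled : ℕ → Set
  Settled T = ∀ t → T ℕ.≤ t →
    stationsAt n t ≡ stationsAt n T × lastAt n t ≡ lastAt n T × paid n t ≡ paid n T × signal n t ≡ 0

  quiet⇒settled : ∀ {T} → (∀ t → T ℕ.≤ t → signal n t ≡ 0) → Settled T
  quiet⇒settled {T} quiet t T≤t =
    let p , q , r = from-to (λ t → stationsAt n t ≡ stationsAt n T × lastAt n t ≡ lastAt n T × paid n t ≡ paid n T)
                            (refl , refl , refl) step T≤t
    in p , q , r , quiet t T≤t
    where
    step : ∀ t → T ℕ.≤ t → stationsAt n t ≡ stationsAt n T × lastAt n t ≡ lastAt n T × paid n t ≡ paid n T →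
           stationsAt n (suc t) ≡ stationsAt n T × lastAt n (suc t) ≡ lastAt n T × paid n (suc t) ≡ paid n T
    step t T≤t (p , q , r) with scan-decreases (scanned n t) | lastAt-suc n t
    ... | inj₂ (≢0 , _)  | _              = ⊥-elim (≢0 (quiet t T≤t))
    ... | _              | inj₂ (≢0 , _)  = ⊥-elim (≢0 (quiet t T≤t))
    ... | inj₁ (_ , eq)  | inj₁ (_ , eq′) = trans eq p , trans eq′ q ,
      trans (trans (paid-suc n t) (trans (cong (λ m → paid n t + out m) (quiet t T≤t)) (+-identityʳ _))) r

  abstract
    settled : ExcludedMiddle 0ℓ → ∃ Settled
    settled em = proj₁ (quiescent em) , quiet⇒settled (proj₂ (quiescent em))

  -- Station j never blocks class n forever: either φ_j is total, or it is
  -- undefined somewhere up to n, and then it does not block at all.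
  Harmless : ℕ → Set
  Harmless j = Total j ⊎ (∀ t → τ j n t ≢ 0)

  module _ (k : ℕ) (harmless : ∀ j → j ℕ.< k → Harmless j) {T : ℕ} (settled-T : Settled T) where

    Drained : Vec Entry n → Set
    Drained e = Empty k e × (∀ j → j ℕ.< k → Total j → sources (at j e) ≡ 0)

    Open : ℕ → ℕ → Set
    Open j t = (τ j n t ≢ 0 ⊎ τ j (lastAt n T) t ≡ 0) × (Total j → τ j n t ≡ 0)

    open-eventually : ∀ j → j ℕ.< k → Eventually (Open j)
    open-eventually j j<k with harmless j j<k
    ... | inj₂ never = 0 , λ t _ → inj₁ (never t) , λ total → ⊥-elim (never _ (proj₂ (total n)))
    ... | inj₁ total = eventually-×
            (proj₁ (total (lastAt n T)) , λ t le → inj₂ (τ-mono j (lastAt n T) (proj₂ (total (lastAt n T))) le))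
            (proj₁ (total n) , λ t le _ → τ-mono j n (proj₂ (total n)) le)

    drained-at : ∀ {t} → T ℕ.≤ t → (∀ j → j ℕ.< k → Open j t) → Drained (stationsAt n t)
    drained-at {t} T≤t open-t = empty , λ j j<k total → ScanProperties.idle-issued n t (lastAt n t) idle j
        (λ l l≤j → empty l (ℕ.≤-trans l≤j j<k)) (proj₂ (open-t j j<k) total)
      where
      idle : Stage.Scan n t (lastAt n t) 0 (stationsAt n t) (stationsAt n (suc t)) 0
      idle = subst (Stage.Scan n t (lastAt n t) 0 (stationsAt n t) (stationsAt n (suc t)))
                   (proj₂ (proj₂ (proj₂ (settled-T t T≤t)))) (scanned n t)
      empty : Empty k (stationsAt n t)
      empty = ScanProperties.idle-empty n t (lastAt n t) idle k λ j j<k →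
        subst (λ v → τ j n t ≢ 0 ⊎ τ j v t ≡ 0) (sym (proj₁ (proj₂ (settled-T t T≤t)))) (proj₁ (open-t j j<k))

    -- The configuration no longer changes, so it may be inspected at a single stage `t′` that is
    -- late enough for all convergences which unblock the stations below k and make their sources
    -- due.
    settled⇒drained : ∀ t → T ℕ.≤ t → Drained (stationsAt n t)
    settled⇒drained t T≤t = subst Drained (trans (proj₁ (settled-T t′ T≤t′)) (sym (proj₁ (settled-T t T≤t))))
      (drained-at T≤t′ (proj₂ all-open t′ (ℕ.m≤m+n (proj₁ all-open) T)))
      where
      all-open : Eventually λ t → ∀ j → j ℕ.< k → Open j t
      all-open = eventually-∀ k open-eventually
      t′ : ℕ
      t′ = proj₁ all-open ℕ.+ T
      T≤t′ : T ℕ.≤ t′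
      T≤t′ = ℕ.m≤n+m T (proj₁ all-open)

  abstract
    drained : ExcludedMiddle 0ℓ → ∀ k → (∀ j → j ℕ.< k → Harmless j) →
              Eventually λ t → Empty k (stationsAt n t) × (∀ j → j ℕ.< k → Total j → sources (at j (stationsAt n t)) ≡ 0)
    drained em k harmless = proj₁ (settled em) , settled⇒drained k harmless (proj₂ (settled em))

  -- At stage a the source of e is still unreleased, so the first e + 1 stations weigh at least
  -- 2^-(n+e) more than in the end. Their balance `W` never decreases, hence the difference has been
  -- paid out.
  payment : ∀ {e a T} → e ℕ.< n → (∀ t → τ e n t ≡ 0 → a ℕ.≤ t) →
            (∀ t → T ℕ.≤ t → Empty (suc e) (stationsAt n t) × sources (at e (stationsAt n t)) ≡ 0) →
            ∀ t → T ℕ.≤ t → a ℕ.≤ t → paid n a + 2^- (n ℕ.+ e) ≤ paid n t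
  payment {e} {a} e<n early final t T≤t a≤t = +-cancelʳ-≤ (V (suc e) 0 (stationsAt n t)) (begin
    paid n a + 2^- (n ℕ.+ e) + v t    ≡⟨ solve 3 (λ p q r → p :+ q :+ r := p :+ (r :+ q)) refl (paid n a) _ (v t) ⟩
    paid n a + (v t + 2^- (n ℕ.+ e))  ≤⟨ +-monoʳ-≤ (paid n a) (V-mono-strict n 0 (stationsAt n t) (stationsAt n a) ℕ.≤-refl
                                       (proj₁ (final t T≤t)) (λ l _ → sources-antitone n l a≤t) unissued) ⟩
    paid n a + v a                    ≤⟨ W-mono n (suc e) a≤t ⟩
    paid n t + v t                    ∎)
    where
    open ≤-Reasoning
    open +-*-Solver
    v : ℕ → ℚ
    v t = V (suc e) 0 (stationsAt n t)
    unissued : sources (at e (stationsAt n t)) ℕ.< sources (at e (stationsAt n a))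
    unissued = subst₂ ℕ._<_ (sym (proj₂ (final t T≤t)))
      (sym (trans (sources-initial n e a λ t′ t′<a eq → ℕ.<⇒≱ t′<a (early t′ eq)) (S-0 n e<n))) (s≤s z≤n)

  -- Payments between consecutive values of s

  module Window {i M T : ℕ} {s : ℕ → ℕ} (increasing : Increasing s)
    (bounds : Bounds i (λ v → s (suc v)))
    (M≤T : M ℕ.≤ T) (converged : τ i n T ≡ 0) (empty : Empty (suc i) (stationsAt n T))
    (frozen : ∀ j → j ℕ.< i → ∀ t → T ℕ.≤ t → sources (at j (stationsAt n t)) ≡ sources (at j (stationsAt n T)))
    where

    δ = 2^- M

    v : ℕ → ℚ
    v t = V i 0 (stationsAt n t)

    fine : ∀ {t} → T ℕ.≤ t → Fine M (at i (stationsAt n t))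
    fine = from-to (λ t → Fine M (at i (stationsAt n t))) (inj₁ (empty i ℕ.≤-refl)) λ t T≤t →
      ScanProperties.fine-step n t (lastAt n t) (scanned n t) (ℕ.≤-trans M≤T T≤t) i

    piece-small : ∀ {t} → T ℕ.≤ t → pieces (at i (stationsAt n t)) ≢ 0 → 2^- exponent (at i (stationsAt n t)) ≤ δ
    piece-small T≤t ≢0 with fine T≤t
    ... | inj₁ ≡0  = ⊥-elim (≢0 ≡0)
    ... | inj₂ M≤d = 2^-antitone M≤d

    v-lower : ∀ {t} → T ℕ.≤ t → v T ≤ v t
    v-lower {t} T≤t = V-mono n i 0 (stationsAt n T) (stationsAt n t) (λ l l<i → empty l (ℕ.m<n⇒m<1+n l<i))
      λ l l<i → ℕ.≤-reflexive (sym (frozen l l<i t T≤t))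

    v-empty : ∀ {t} → T ℕ.≤ t → Empty i (stationsAt n t) → v t ≤ v T
    v-empty {t} T≤t empty′ = V-mono n i 0 (stationsAt n t) (stationsAt n T) empty′
      λ l l<i → ℕ.≤-reflexive (frozen l l<i t T≤t)

    drop-out : ∀ {m p q} → out m + p ≡ q → p ≤ q
    drop-out {m} eq = ≤-trans (p≤q+p (out-nonneg m)) (≤-reflexive eq)

    -- A piece enters the stations below i only when these are empty, so when their weight is that
    -- of their frozen sources, at most `v T`. Without an entry the weight cannot grow.
    v-upper : ∀ {t} → T ℕ.≤ t → v t ≤ v T + δ
    v-upper = from-to (λ t → v t ≤ v T + δ) (p≤p+q (2^-nonneg M)) step
      where
      step : ∀ t → T ℕ.≤ t → v t ≤ v T + δ → v (suc t) ≤ v T + δ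
      step t T≤t le with Flow-at n i t
      ... | inj₁ eq = ≤-trans (drop-out {signal n t} eq) le
      ... | inj₂ tr = ≤-trans (drop-out {signal n t} (Transfer.gain tr))
              (+-mono-≤ (v-empty T≤t (Transfer.below-empty tr)) (piece-small T≤t (Transfer.nonempty tr)))

    module _ (k : ℕ) (T≤a : T ℕ.≤ s k) where
      a = s k
      b = s (suc k)

      -- Once a piece has left station i after stage a, the last move dates from a or later, and
      -- this is what excludes a second piece before b.
      AtMostOne : ℕ → Set
      AtMostOne t = t ℕ.≤ b → W n i t ≤ W n i a ⊎ (a ℕ.≤ lastAt n t × W n i t ≤ W n i a + δ)

      u-late : ∀ {t} → a ℕ.≤ t → a ℕ.≤ lastAt n t → a ℕ.≤ lastAt n (suc t)
      u-late {t} a≤t a≤u with lastAt-suc n t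
      ... | inj₁ (_ , eq) = ℕ.≤-trans a≤u (ℕ.≤-reflexive (sym eq))
      ... | inj₂ (_ , eq) = ℕ.≤-trans a≤t (ℕ.≤-reflexive (sym eq))

      -- Convergence on u by stage t would give s(u+1) ≤ t < b, but u ≥ s(k) ≥ k yields s(u+1) ≥
      -- s(k+1) = b.
      no-second : ∀ {t} → t ℕ.< b → a ℕ.≤ lastAt n t → τ i (lastAt n t) t ≢ 0
      no-second {t} t<b a≤u ≡0 = ℕ.<⇒≱ (ℕ.≤-<-trans (bounds (lastAt n t) t ≡0) t<b) (later (ℕ.≤-trans (inflationary increasing k) a≤u))
        where
        later : ∀ {m} → k ℕ.≤ m → b ℕ.≤ s (suc m)
        later {m} k≤m with ℕ.m≤n⇒m<n∨m≡n k≤m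
        ... | inj₁ k<m  = ℕ.<⇒≤ (increasing (s≤s k<m))
        ... | inj₂ refl = ℕ.≤-refl

      at-most-one : ∀ {t} → a ℕ.≤ t → AtMostOne t
      at-most-one = from-to AtMostOne (λ _ → inj₁ ≤-refl) step
        where
        step : ∀ t → a ℕ.≤ t → AtMostOne t → AtMostOne (suc t)
        step t a≤t ih t<b with Flow-at n i t | ih (ℕ.<⇒≤ t<b)
        ... | inj₁ eq | inj₁ le = inj₁ (≤-trans (≤-reflexive (trans (W-suc n i t) (cong (_+_ (paid n t)) eq))) le)
        ... | inj₁ eq | inj₂ (late , le) =
          inj₂ (u-late a≤t late , ≤-trans (≤-reflexive (trans (W-suc n i t) (cong (_+_ (paid n t)) eq))) le)
        ... | inj₂ tr | inj₂ (late , le) = ⊥-elim (no-second t<b late (τ-u (Transfer.allowed tr)))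
          where
          τ-u : τ i n t ≢ 0 ⊎ τ i (lastAt n t) t ≡ 0 → τ i (lastAt n t) t ≡ 0
          -- Free passage is over: φᵢ has converged on 0, ..., n by stage `T`.
          τ-u (inj₁ ≢0) = ⊥-elim (≢0 (τ-mono i n converged (ℕ.≤-trans T≤a a≤t)))
          τ-u (inj₂ ≡0) = ≡0
        ... | inj₂ tr | inj₁ le with lastAt-suc n t
        ...   | inj₁ (≡0 , _) = ⊥-elim (Transfer.active tr ≡0)
        -- The transfer is itself a move, so the last move is now at t ≥ a.
        ...   | inj₂ (_ , eq) = inj₂ (ℕ.≤-trans a≤t (ℕ.≤-reflexive (sym eq)) ,
          ≤-trans (≤-reflexive (trans (W-suc n i t) (trans (cong (_+_ (paid n t)) (Transfer.gain tr)) (sym (+-assoc (paid n t) _ _)))))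
            (+-mono-≤ le (piece-small (ℕ.≤-trans T≤a a≤t) (Transfer.nonempty tr))))

      -- One δ is the piece that leaves station i in the window; the other is what may be in transit
      -- below station i at its beginning.
      window : paid n b ≤ paid n a + (δ + δ)
      window = +-cancelʳ-≤ (v T) (begin
        paid n b + v T           ≤⟨ +-monoʳ-≤ (paid n b) (v-lower (ℕ.≤-trans T≤a a≤b)) ⟩
        paid n b + v b           ≤⟨ one (at-most-one a≤b ℕ.≤-refl) ⟩
        paid n a + v a + δ       ≤⟨ +-monoˡ-≤ δ (+-monoʳ-≤ (paid n a) (v-upper T≤a)) ⟩
        paid n a + (v T + δ) + δ ≡⟨ solve 3 (λ p q r → p :+ (q :+ r) :+ r := p :+ (r :+ r) :+ q) refl (paid n a) (v T) δ ⟩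
        paid n a + (δ + δ) + v T ∎)
        where
        open ≤-Reasoning
        open +-*-Solver
        a≤b = ℕ.<⇒≤ (increasing (ℕ.n<1+n k))
        one : W n i b ≤ W n i a ⊎ (a ℕ.≤ lastAt n b × W n i b ≤ W n i a + δ) → W n i b ≤ W n i a + δ
        one (inj₁ le)       = ≤-trans le (p≤p+q (2^-nonneg M))
        one (inj₂ (_ , le)) = le

-- Recursiveness of the runs

module Coding where

  
  encodeEntry : Entry → ℕ
  encodeEntry (entry s r d) = pair s (pair r d)

  encodeList : ∀ {k} → Vec Entry k → ℕ
  encodeList []       = 0
  encodeList (e ∷ es) = pair (encodeEntry e) (encodeList es)

  encodeResult : ∀ {k} → Vec Entry k × ℕ → ℕ
  encodeResult (es , m) = pair (encodeList es) m

  encodeState : ∀ {n} → State n → ℕ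
  encodeState (state u es a b) = pair u (pair (encodeList es) (pair a b))

  -- The predecessor of the signal is nonzero exactly for signals 2 + d, so it tests whether a piece
  -- was emitted.
  receive# : ℕ → ℕ → ℕ → ℕ → ℕ
  receive# t s d res = ite (pred (right res))
    (pair (pair (pair s (pair (2 ^ t) (pred (pred (right res)) ℕ.+ t))) (left res)) 1)
    (pair (pair (pair s (pair 0 d)) (left res)) (right res))

  visit# : ℕ → ℕ → ℕ → ℕ → ℕ → ℕ → ℕ → ℕ → ℕ
  visit# n t i e l h w res = ite r
    (ite h (pair (pair e l) 0) (pair (pair (pair s (pair (pred r) d)) l) (2 ℕ.+ d)))
    (ite w (pair (pair (pair (pred s) (pair (2 ^ t) (n ℕ.+ i ℕ.+ t))) l) 1) (receive# t s d res))
    where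
    s = left e
    r = left (right e)
    d = right (right e)

  module _ (n t u : ℕ) where
    open Stage n t u

    receive#-correct : ∀ {k} s d (res : Vec Entry k × ℕ) →
                       receive# t s d (encodeResult res) ≡ encodeResult (receive s d res)
    receive#-correct s d (es , 0) rewrite right-pair (encodeList es) 0 | left-pair (encodeList es) 0 = refl
    receive#-correct s d (es , 1) rewrite right-pair (encodeList es) 1 | left-pair (encodeList es) 1 = refl
    receive#-correct s d (es , suc (suc m))
      rewrite right-pair (encodeList es) (2 ℕ.+ m) | left-pair (encodeList es) (2 ℕ.+ m) = refl

    visit#-correct : ∀ {k} i e (es : Vec Entry k) h w res →
      visit# n t i (encodeEntry e) (encodeList es) h w (encodeResult res) ≡ encodeResult (visit i e es h w res)
    visit#-correct i (entry s (suc r) d) es zero w res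
      rewrite left-pair s (pair (suc r) d) | right-pair s (pair (suc r) d)
            | left-pair (suc r) d | right-pair (suc r) d = refl
    visit#-correct i (entry s (suc r) d) es (suc h) w res
      rewrite right-pair s (pair (suc r) d) | left-pair (suc r) d = refl
    visit#-correct i (entry s zero d) es h (suc w) res
      rewrite left-pair s (pair 0 d) | right-pair s (pair 0 d) | left-pair 0 d = refl
    visit#-correct i (entry s zero d) es h zero res
      rewrite left-pair s (pair 0 d) | right-pair s (pair 0 d) | left-pair 0 d | right-pair 0 d =
      receive#-correct s d res

  dropped : ℕ → ℕ → ℕ
  dropped l = natrec l (λ _ → right)

  -- `scan` needs the result for the stations above first, so the iteration starts at the top: round
  -- j treats station n - (j+1), found by dropping the entries before it.
  scan-step# : ℕ → ℕ → ℕ → ℕ → ℕ → ℕ → ℕ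
  scan-step# n t u l j res =
    let i = n ℕ.∸ suc j; z = dropped l i; e = left z
    in visit# n t i e (right z) (ite (τ i n t) 0 (τ i u t)) (ite (τ i n t) 0 (left e)) res

  scan# : ℕ → ℕ → ℕ → ℕ → ℕ → ℕ
  scan# n t u l = natrec (pair 0 0) (scan-step# n t u l)

  scan#-correct : ∀ n t u l {k} i (es : Vec Entry k) → i ℕ.+ k ≡ n → dropped l i ≡ encodeList es →
                  scan# n t u l k ≡ encodeResult (Stage.scan n t u i es)
  scan#-correct n t u l i []       len eq = refl
  scan#-correct n t u l {suc k} i (e ∷ es) len eq
    rewrite scan#-correct n t u l (suc i) es (trans (sym (ℕ.+-suc i k)) len)
              (trans (cong right eq) (right-pair (encodeEntry e) (encodeList es)))
          | trans (cong (ℕ._∸ suc k) (sym len)) (ℕ.m+n∸n≡m i (suc k))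
          | eq | left-pair (encodeEntry e) (encodeList es) | right-pair (encodeEntry e) (encodeList es) =
    trans (cong (λ s → visit# n t i (encodeEntry e) (encodeList es) hold (ite (τ i n t) 0 s) (encodeResult above′))
                (left-pair (sources e) (pair (pieces e) (exponent e))))
          (visit#-correct n t u i e es hold (ite (τ i n t) 0 (sources e)) above′)
    where
    hold = ite (τ i n t) 0 (τ i u t)
    above′ = Stage.scan n t u (suc i) es

  advance# : ℕ → ℕ → ℕ → ℕ
  advance# n t z =
    pair (ite m t u) (pair (left res)
      (pair (ite (pred m) (a ℕ.* 2 ^ pred (pred m) ℕ.+ 1 ℕ.* 2 ^ b) a) (ite (pred m) (b ℕ.+ pred (pred m)) b)))
    where
    u = left z
    l = left (right z)
    a = left (right (right z))
    b = right (right (right z))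
    res = scan# n t u l n
    m = right res

  advance#-correct : ∀ {n} t (st : State n) → advance# n t (encodeState st) ≡ encodeState (advance t st)
  advance#-correct {n} t (state u es a b)
    rewrite left-pair u (pair (encodeList es) (pair a b)) | right-pair u (pair (encodeList es) (pair a b))
          | left-pair (encodeList es) (pair a b) | right-pair (encodeList es) (pair a b)
          | left-pair a b | right-pair a b
          | scan#-correct n t u (encodeList es) 0 es refl refl
    with Stage.scan n t u 0 es
  ... | es′ , 0 rewrite left-pair (encodeList es′) 0 | right-pair (encodeList es′) 0 = refl
  ... | es′ , 1 rewrite left-pair (encodeList es′) 1 | right-pair (encodeList es′) 1 = refl
  ... | es′ , suc (suc d) rewrite left-pair (encodeList es′) (2 ℕ.+ d) | right-pair (encodeList es′) (2 ℕ.+ d) = refl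

  initial# : ℕ → ℕ
  initial# n = pair 0 (pair (natrec 0 (λ _ → pair (pair 1 (pair 0 0))) n) (pair 0 0))

  initial#-correct : ∀ n → initial# n ≡ encodeState (class n 0)
  initial#-correct n = cong (λ l → pair 0 (pair l (pair 0 0))) (lem n)
    where
    lem : ∀ n → natrec 0 (λ _ → pair (pair 1 (pair 0 0))) n ≡ encodeList (replicate n (entry 1 0 0))
    lem zero    = refl
    lem (suc n) = cong (pair (pair 1 (pair 0 0))) (lem n)

  class# : ℕ → ℕ → ℕ
  class# n = natrec (initial# n) (advance# n)

  class#-correct : ∀ n t → class# n t ≡ encodeState (class n t)
  class#-correct n zero    = initial#-correct n
  class#-correct n (suc t) = trans (cong (advance# n t) (class#-correct n t)) (advance#-correct t (class n t))

  private
    variable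
      arity : ℕ
      f g h k f₁ f₂ f₃ f₄ : Vec ℕ arity → ℕ

  receiveᶜ : Recursive f → Recursive g → Recursive h → Recursive k →
             Recursive (λ xs → receive# (f xs) (g xs) (h xs) (k xs))
  receiveᶜ t s d res = iteᶜ (predᶜ (rightᶜ res))
    (pairᶜ (pairᶜ (pairᶜ s (pairᶜ (2^ᶜ t) (predᶜ (predᶜ (rightᶜ res)) +ᶜ t))) (leftᶜ res)) (constᶜ 1))
    (pairᶜ (pairᶜ (pairᶜ s (pairᶜ zeroᶜ d)) (leftᶜ res)) (rightᶜ res))

  visitᶜ : Recursive f → Recursive g → Recursive h → Recursive k →
           Recursive f₁ → Recursive f₂ → Recursive f₃ → Recursive f₄ →
           Recursive (λ xs → visit# (f xs) (g xs) (h xs) (k xs) (f₁ xs) (f₂ xs) (f₃ xs) (f₄ xs))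
  visitᶜ n t i e l h w res = iteᶜ r
    (iteᶜ h (pairᶜ (pairᶜ e l) zeroᶜ) (pairᶜ (pairᶜ (pairᶜ s (pairᶜ (predᶜ r) d)) l) (sucᶜ (sucᶜ d))))
    (iteᶜ w (pairᶜ (pairᶜ (pairᶜ (predᶜ s) (pairᶜ (2^ᶜ t) (n +ᶜ i +ᶜ t))) l) (constᶜ 1)) (receiveᶜ t s d res))
    where
    s = leftᶜ e
    r = leftᶜ (rightᶜ e)
    d = rightᶜ (rightᶜ e)

  droppedᶜ : Recursive f → Recursive g → Recursive (λ xs → dropped (f xs) (g xs))
  droppedᶜ l i = rec l (rightᶜ (var 1F)) i

  advanceᶜ : Recursive₃ advance#
  advanceᶜ = pairᶜ (iteᶜ m (var 1F) (leftᶜ (var 2F))) (pairᶜ (leftᶜ res)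
      (pairᶜ (iteᶜ (predᶜ m) (a *ᶜ 2^ᶜ (predᶜ (predᶜ m)) +ᶜ constᶜ 1 *ᶜ 2^ᶜ b) a)
             (iteᶜ (predᶜ m) (b +ᶜ predᶜ (predᶜ m)) b)))
    where
    a = leftᶜ (rightᶜ (rightᶜ (var 2F)))
    b = rightᶜ (rightᶜ (rightᶜ (var 2F)))
    i = var 2F ∸ᶜ sucᶜ (var 0F)
    z = droppedᶜ (leftᶜ (rightᶜ (var 4F))) i
    hold = τᶜ i (var 2F) (var 3F)
    res = rec (pairᶜ zeroᶜ zeroᶜ)
      (visitᶜ (var 2F) (var 3F) i (leftᶜ z) (rightᶜ z)
        (iteᶜ hold zeroᶜ (τᶜ i (leftᶜ (var 4F)) (var 3F))) (iteᶜ hold zeroᶜ (leftᶜ (leftᶜ z))) (var 1F))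
      (var 0F)
    m = rightᶜ res

  classᶜ : Recursive f → Recursive g → Recursive (λ xs → encodeState (class (f xs) (g xs)))
  classᶜ = app₂ (λ n t → encodeState (class n t)) (ext (λ xs → class#-correct (lookup xs 0F) (lookup xs 1F))
    (rec (pairᶜ zeroᶜ (pairᶜ (rec zeroᶜ (pairᶜ (pairᶜ (constᶜ 1) (pairᶜ zeroᶜ zeroᶜ)) (var 1F)) (var 0F))
                             (pairᶜ zeroᶜ zeroᶜ)))
         (app₃ advance# advanceᶜ (var 2F) (var 0F) (var 1F)) (var 1F)))

  module _ {n} (st : State n) where
    open State st

    decode-rest : right (encodeState st) ≡ pair (encodeList stations) (pair num denom)
    decode-rest = right-pair last _

    decode-stations : left (right (encodeState st)) ≡ encodeList stations
    decode-stations = trans (cong left decode-rest) (left-pair _ _)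

    decode-num : left (right (right (encodeState st))) ≡ num
    decode-num = trans (cong left (trans (cong right decode-rest) (right-pair _ _))) (left-pair num denom)

    decode-denom : right (right (right (encodeState st))) ≡ denom
    decode-denom = trans (cong right (trans (cong right decode-rest) (right-pair _ _))) (right-pair num denom)

  stationsᶜ : Recursive f → Recursive g → Recursive (λ xs → encodeList (stationsAt (f xs) (g xs)))
  stationsᶜ {f = f} {g} n t = ext (λ xs → trans (decode-stations (class (f xs) (g xs))) (cong encodeList (sym (stationsAt-≡ (f xs) (g xs))))) (leftᶜ (rightᶜ (classᶜ n t)))

  numᶜ : Recursive f → Recursive g → Recursive (λ xs → State.num (class (f xs) (g xs)))
  numᶜ {f = f} {g} n t = ext (λ xs → decode-num (class (f xs) (g xs))) (leftᶜ (rightᶜ (rightᶜ (classᶜ n t))))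

  denomᶜ : Recursive f → Recursive g → Recursive (λ xs → State.denom (class (f xs) (g xs)))
  denomᶜ {f = f} {g} n t = ext (λ xs → decode-denom (class (f xs) (g xs))) (rightᶜ (rightᶜ (rightᶜ (classᶜ n t))))

open Coding

-- The limit of the payments of all classes

open State using (num; denom)

denΣ : ℕ → ℕ → ℕ
denΣ t = natrec 0 λ n d → d ℕ.+ denom (class n t)

numΣ : ℕ → ℕ → ℕ
numΣ t = natrec 0 λ n a → a ℕ.* 2 ^ denom (class n t) ℕ.+ num (class n t) ℕ.* 2 ^ denΣ t n

Σpaid : ℕ → ℕ → ℚ
Σpaid k t = numΣ t k · 2^- denΣ t k

Σpaid-suc : ∀ k t → Σpaid (suc k) t ≡ Σpaid k t + paid k t
Σpaid-suc k t = trans (sym (add-dyadic (numΣ t k) (denΣ t k) (num (class k t)) (denom (class k t))))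
                      (cong (_+_ (Σpaid k t)) (sym (paid-≡ k t)))

-- Class n enters only after stage n, which keeps the sum finite; payments are nonnegative, so late
-- entries do not harm monotonicity.
approx : ℕ → ℚ
approx t = Σpaid t t

denΣᶜ : ∀ {m} {f g : Vec ℕ m → ℕ} → Recursive f → Recursive g → Recursive (λ xs → denΣ (f xs) (g xs))
denΣᶜ = app₂ denΣ (rec zeroᶜ (var 1F +ᶜ denomᶜ (var 0F) (var 2F)) (var 1F))

numΣᶜ : ∀ {m} {f g : Vec ℕ m → ℕ} → Recursive f → Recursive g → Recursive (λ xs → numΣ (f xs) (g xs))
numΣᶜ = app₂ numΣ (rec zeroᶜ
  (var 1F *ᶜ 2^ᶜ (denomᶜ (var 0F) (var 2F)) +ᶜ numᶜ (var 0F) (var 2F) *ᶜ 2^ᶜ (denΣᶜ (var 2F) (var 0F))) (var 1F))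

approx-computable : Computableℚ approx
approx-computable =
  (λ t → numΣ t t) , (λ _ → 0) , (λ t → 2^∸1 (denΣ t t)) ,
  toComputable (numΣᶜ (var 0F) (var 0F)) , toComputable zeroᶜ ,
  toComputable (predᶜ (2^ᶜ (denΣᶜ (var 0F) (var 0F)))) ,
  λ t → ·2^-≡/ (numΣ t t) (denΣ t t)

Σpaid-gain : ∀ {n a b g} k → n ℕ.< k → a ℕ.≤ b → paid n a + g ≤ paid n b → Σpaid k a + g ≤ Σpaid k b
Σpaid-mono : ∀ k {a b} → a ℕ.≤ b → Σpaid k a ≤ Σpaid k b

Σpaid-mono zero    a≤b = ≤-refl
Σpaid-mono (suc k) {a} {b} a≤b = subst₂ _≤_ (sym (Σpaid-suc k a)) (sym (Σpaid-suc k b))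
  (+-mono-≤ (Σpaid-mono k a≤b) (paid-mono k a≤b))

Σpaid-gain {n} {a} {b} {g} (suc k) n<1+k a≤b le =
  subst₂ (λ p q → p + g ≤ q) (sym (Σpaid-suc k a)) (sym (Σpaid-suc k b)) (go (ℕ.m≤n⇒m<n∨m≡n (ℕ.s≤s⁻¹ n<1+k)))
  where
  open +-*-Solver
  go : n ℕ.< k ⊎ n ≡ k → Σpaid k a + paid k a + g ≤ Σpaid k b + paid k b
  go (inj₁ n<k)  = ≤-trans (≤-reflexive (solve 3 (λ p q r → p :+ q :+ r := p :+ r :+ q) refl (Σpaid k a) (paid k a) g))
                     (+-mono-≤ (Σpaid-gain k n<k a≤b le) (paid-mono k a≤b))
  go (inj₂ refl) = ≤-trans (≤-reflexive (+-assoc (Σpaid k a) (paid k a) g)) (+-mono-≤ (Σpaid-mono k a≤b) le)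

Σpaid-monoˡ : ∀ {j k} t → j ℕ.≤ k → Σpaid j t ≤ Σpaid k t
Σpaid-monoˡ {j} t = from-to (λ k → Σpaid j t ≤ Σpaid k t) ≤-refl λ k _ le →
  ≤-trans le (≤-trans (p≤p+q (paid-nonneg k t)) (≤-reflexive (sym (Σpaid-suc k t))))

approx-mono : NonDecreasing approx
approx-mono {a} {b} a≤b = ≤-trans (Σpaid-mono a a≤b) (Σpaid-monoˡ b a≤b)

double : ℚ → ℚ
double p = p + p

quad-suc : ∀ n → double (double (2^- suc n)) ≡ double (2^- n)
quad-suc n = cong double (2^-half n)

-- Class n pays at most 2 · 2^-n, so the classes from j on pay at most 4 · 2^-j together; adding
-- this reserve on both sides makes the estimate telescope.
Σpaid-tail : ∀ {k j} t → k ℕ.≤ j → Σpaid j t + double (double (2^- j)) ≤ Σpaid k t + double (double (2^- k))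
Σpaid-tail {k} t = from-to (λ j → Σpaid j t + double (double (2^- j)) ≤ Σpaid k t + double (double (2^- k))) ≤-refl
  λ j _ le → ≤-trans (subst₂ (λ p q → p + q ≤ Σpaid j t + double (double (2^- j))) (sym (Σpaid-suc j t)) (sym (quad-suc j))
    (≤-trans (≤-reflexive (+-assoc (Σpaid j t) _ _)) (+-monoʳ-≤ (Σpaid j t) (+-monoˡ-≤ (double (2^- j)) (paid-bound j t))))) le

quad-nonneg : ∀ n → 0ℚ ≤ double (double (2^- n))
quad-nonneg n = +-nonneg two two
  where two = +-nonneg (2^-nonneg n) (2^-nonneg n)

approx-bound : ∀ t → approx t ≤ double (double (2^- 0))
approx-bound t = ≤-trans (p≤p+q (quad-nonneg t)) (≤-trans (Σpaid-tail {0} {t} t z≤n) (≤-reflexive (+-identityˡ _)))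

Σpaid-close : ∀ c {a b} k → (∀ n → n ℕ.< k → paid n b ≤ paid n a + 2^- (n ℕ.+ c)) →
              Σpaid k b + double (2^- (k ℕ.+ c)) ≤ Σpaid k a + double (2^- c)
Σpaid-close c         zero    close = ≤-refl
Σpaid-close c {a} {b} (suc k) close = begin
  Σpaid (suc k) b + double (2^- suc (k ℕ.+ c)) ≡⟨ cong₂ _+_ (Σpaid-suc k b) (2^-half (k ℕ.+ c)) ⟩
  Σpaid k b + paid k b + w                     ≤⟨ +-monoˡ-≤ w (+-monoʳ-≤ (Σpaid k b) (close k ℕ.≤-refl)) ⟩
  Σpaid k b + (paid k a + w) + w               ≡⟨ solve 3 (λ p q w → p :+ (q :+ w) :+ w := p :+ (w :+ w) :+ q) refl (Σpaid k b) (paid k a) w ⟩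
  Σpaid k b + double w + paid k a              ≤⟨ +-monoˡ-≤ (paid k a) (Σpaid-close c {a} {b} k λ n n<k → close n (ℕ.m<n⇒m<1+n n<k)) ⟩
  Σpaid k a + double (2^- c) + paid k a        ≡⟨ solve 3 (λ p q r → p :+ q :+ r := p :+ r :+ q) refl (Σpaid k a) (double (2^- c)) (paid k a) ⟩
  Σpaid k a + paid k a + double (2^- c)        ≡⟨ cong (_+ double (2^- c)) (Σpaid-suc k a) ⟨
  Σpaid (suc k) a + double (2^- c)             ∎
  where
  open ≤-Reasoning
  open +-*-Solver
  w = 2^- (k ℕ.+ c)

-- With c = 3 + m, the first 4 + m classes contribute at most 2 · 2^-c, and the remaining ones 4 ·
-- 2^-(4+m) = 2 · 2^-c. Together this is 2^-(m+1).
approx-close : ∀ m {a b} → 4 ℕ.+ m ℕ.≤ a → a ℕ.≤ b →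
               (∀ n → n ℕ.< 4 ℕ.+ m → paid n b ≤ paid n a + 2^- (n ℕ.+ (3 ℕ.+ m))) →
               approx b ≤ approx a + 2^- suc m
approx-close m {a} {b} K≤a a≤b close = begin
  Σpaid b b                                            ≤⟨ p≤p+q (quad-nonneg b) ⟩
  Σpaid b b + double (double (2^- b))                  ≤⟨ Σpaid-tail b (ℕ.≤-trans K≤a a≤b) ⟩
  Σpaid K b + double (double (2^- K))                  ≤⟨ +-monoˡ-≤ (double (double (2^- K))) (≤-trans (p≤p+q {Σpaid K b} (+-nonneg (2^-nonneg (K ℕ.+ c)) (2^-nonneg (K ℕ.+ c)))) (Σpaid-close c {a} {b} K close)) ⟩
  Σpaid K a + double (2^- c) + double (double (2^- K)) ≡⟨ cong (_+_ (Σpaid K a + double (2^- c))) (quad-suc c) ⟩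
  Σpaid K a + double (2^- c) + double (2^- c)          ≡⟨ +-assoc (Σpaid K a) _ _ ⟩
  Σpaid K a + double (double (2^- c))                  ≡⟨ cong (λ p → Σpaid K a + double p) (2^-half (2 ℕ.+ m)) ⟩
  Σpaid K a + double (2^- (2 ℕ.+ m))                   ≡⟨ cong (_+_ (Σpaid K a)) (2^-half (1 ℕ.+ m)) ⟩
  Σpaid K a + 2^- suc m                                ≤⟨ +-monoˡ-≤ (2^- suc m) (Σpaid-monoˡ {K} {a} a K≤a) ⟩
  approx a + 2^- suc m                                 ∎
  where
  open ≤-Reasoning
  K = 4 ℕ.+ m
  c = 3 ℕ.+ m

p<p+q : ∀ p {q} → 0ℚ < q → p < p + q
p<p+q p 0<q = subst (_< p + _) (+-identityʳ p) (+-monoʳ-< p 0<q)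

p-q<p : ∀ p {q} → 0ℚ < q → p - q < p
p-q<p p 0<q = subst (p - _ <_) (+-identityʳ p) (+-monoʳ-< p (neg-antimono-< 0<q))

module _ (em : ExcludedMiddle 0ℓ) where

  -- The supremum of the approximations. The upper cut asks for a bound strictly below p, which
  -- makes it rounded; excluded middle enters in `located` alone, to decide whether some
  -- approximation exceeds p.
  limit : ℝ
  limit = record
    { L         = λ p → ∃ λ t → p < approx t
    ; U         = λ p → ∃ λ r → r < p × (∀ t → approx t ≤ r)
    ; L-inhab   = approx 0 - 1ℚ , 0 , p-q<p (approx 0) 0<1
    ; U-inhab   = top + 1ℚ , top , p<p+q top 0<1 , approx-bound
    ; L-rounded = λ p → mk⇔
        (λ { (t , p<q) → let r , p<r , r<q = <-dense p<q in r , p<r , t , r<q })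
        (λ { (r , p<r , t , r<q) → t , <-trans p<r r<q })
    ; U-rounded = λ p → mk⇔
        (λ { (r , r<p , le) → let r′ , r<r′ , r′<p = <-dense r<p in r′ , r′<p , r , r<r′ , le })
        (λ { (r , r<p , r′ , r′<r , le) → r′ , <-trans r′<r r<p , le })
    ; disjoint  = λ { p ((t , p<q) , r , r<p , le) → <-irrefl refl (<-≤-trans p<q (≤-trans (le t) (<⇒≤ r<p))) }
    ; located   = located′
    }
    where
    top = double (double (2^- 0))
    0<1 : 0ℚ < 1ℚ
    0<1 = 2^-pos 0
    located′ : ∀ {p r} → p < r → (∃ λ t → p < approx t) ⊎ (∃ λ r′ → r′ < r × (∀ t → approx t ≤ r′))
    located′ {p} p<r with em {∃ λ t → p < approx t}
    ... | yes below = inj₁ below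
    ... | no  none  = inj₂ (p , p<r , λ t → ≮⇒≥ λ p<q → none (t , p<q))

  abstract
    settled-below : ∀ k → Eventually λ T → ∀ n → n ℕ.< k → ∀ t → T ℕ.≤ t → paid n t ≤ paid n T
    settled-below k = eventually-∀ k λ n _ →
      let T , final = settled n em in
      T , λ T′ T≤T′ t T′≤t → ≤-reflexive (trans (proj₁ (proj₂ (proj₂ (final t (ℕ.≤-trans T≤T′ T′≤t)))))
                                                 (sym (proj₁ (proj₂ (proj₂ (final T′ T≤T′))))))

  approx-cauchy : ∀ m → ∃ λ N → ∀ t → approx t ≤ approx N + 2^- suc m
  approx-cauchy m = N , bound
    where
    T = proj₁ (settled-below (4 ℕ.+ m))
    N = T ℕ.+ (4 ℕ.+ m)
    bound : ∀ t → approx t ≤ approx N + 2^- suc m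
    bound t with ℕ.≤-total t N
    ... | inj₁ t≤N = ≤-trans (approx-mono t≤N) (p≤p+q (2^-nonneg (suc m)))
    ... | inj₂ N≤t = approx-close m (ℕ.m≤n+m (4 ℕ.+ m) T) N≤t λ n n<K →
      ≤-trans (proj₂ (settled-below (4 ℕ.+ m)) N (ℕ.m≤m+n T _) n n<K t N≤t) (p≤p+q (2^-nonneg (n ℕ.+ (3 ℕ.+ m))))

  approx⟶limit : approx ⟶ limit
  approx⟶limit ε 0<ε = N , λ n N≤n →
    (n , p-q<p (approx n) 0<ε) ,
    approx n + 2^- suc m , +-monoʳ-< (approx n) (≤-<-trans (2^-suc-≤ m) small) ,
    λ t → ≤-trans (bound t) (+-monoˡ-≤ _ (approx-mono N≤n))
    where
    m = proj₁ (archimedean ε 0<ε)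
    small = proj₂ (archimedean ε 0<ε)
    N = proj₁ (approx-cauchy m)
    bound = proj₂ (approx-cauchy m)

  limit-leftComputable : LeftComputable limit
  limit-leftComputable = approx , approx-computable , approx-mono , approx⟶limit

-- Near computability

sumTo : (ℕ → ℕ) → ℕ → ℕ
sumTo f = natrec 0 λ n a → a ℕ.+ f n

≤-sumTo : ∀ f {n k} → n ℕ.< k → f n ℕ.≤ sumTo f k
≤-sumTo f {n} {suc k} n<1+k with ℕ.m≤n⇒m<n∨m≡n (ℕ.s≤s⁻¹ n<1+k)
... | inj₁ n<k  = ℕ.≤-trans (≤-sumTo f n<k) (ℕ.m≤m+n _ (f k))
... | inj₂ refl = ℕ.m≤n+m (f k) (sumTo f k)

distance : ℕ → ℕ → ℕ
distance a b = (a ∸ b) ℕ.+ (b ∸ a)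

distance-≡ : ∀ {a b} → distance a b ≡ 0 → a ≡ b
distance-≡ {a} {b} eq = ℕ.≤-antisym (ℕ.m∸n≡0⇒m≤n (ℕ.m+n≡0⇒m≡0 (a ∸ b) eq)) (ℕ.m∸n≡0⇒m≤n (ℕ.m+n≡0⇒n≡0 (a ∸ b) eq))

-- Vanishes on the code of a list iff its first k stations are empty and have
-- β 0, …, β (k − 1) sources left.
mismatch : (ℕ → ℕ) → ℕ → ℕ → ℕ
mismatch β zero    l = 0
mismatch β (suc k) l =
  left (right (left l)) ℕ.+ distance (left (left l)) (β 0) ℕ.+ mismatch (λ j → β (suc j)) k (right l)

-- For fixed k only the finitely many values β 0, ..., β (k - 1) enter, each as a constant of the
-- code; this is how noncomputable finite information is used.
mismatchᶜ : ∀ {m} {f : Vec ℕ m → ℕ} β k → Recursive f → Recursive (λ xs → mismatch β k (f xs))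
mismatchᶜ β zero    l = zeroᶜ
mismatchᶜ β (suc k) l =
  leftᶜ (rightᶜ (leftᶜ l)) +ᶜ (leftᶜ (leftᶜ l) ∸ᶜ constᶜ (β 0) +ᶜ (constᶜ (β 0) ∸ᶜ leftᶜ (leftᶜ l)))
  +ᶜ mismatchᶜ (λ j → β (suc j)) k (rightᶜ l)

Matches : ∀ {n} → (ℕ → ℕ) → ℕ → Vec Entry n → Set
Matches β k es = Empty k es × (∀ j → j ℕ.< k → sources (at j es) ≡ β j)

module _ {n} (β : ℕ → ℕ) (k : ℕ) (e : Entry) (es : Vec Entry n) where

  mismatch-∷ : mismatch β (suc k) (encodeList (e ∷ es)) ≡
               pieces e ℕ.+ distance (sources e) (β 0) ℕ.+ mismatch (λ j → β (suc j)) k (encodeList es)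
  mismatch-∷ rewrite left-pair (encodeEntry e) (encodeList es) | right-pair (encodeEntry e) (encodeList es)
    | left-pair (sources e) (pair (pieces e) (exponent e)) | right-pair (sources e) (pair (pieces e) (exponent e))
    | left-pair (pieces e) (exponent e) = refl

mismatch⇒matches : ∀ {n} β k (es : Vec Entry n) → k ℕ.≤ n → mismatch β k (encodeList es) ≡ 0 → Matches β k es
mismatch⇒matches β zero    es       _         eq = (λ _ ()) , λ _ ()
mismatch⇒matches β (suc k) (e ∷ es) (s≤s k≤n) eq =
  (λ { zero _ → ℕ.m+n≡0⇒m≡0 (pieces e) fst ; (suc j) (s≤s j<k) → proj₁ rest j j<k }) ,
  (λ { zero _ → distance-≡ (ℕ.m+n≡0⇒n≡0 (pieces e) fst) ; (suc j) (s≤s j<k) → proj₂ rest j j<k })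
  where
  eq′ = trans (sym (mismatch-∷ β k e es)) eq
  fst : pieces e ℕ.+ distance (sources e) (β 0) ≡ 0
  fst = ℕ.m+n≡0⇒m≡0 _ eq′
  rest = mismatch⇒matches (λ j → β (suc j)) k es k≤n (ℕ.m+n≡0⇒n≡0 (pieces e ℕ.+ distance (sources e) (β 0)) eq′)

matches⇒mismatch : ∀ {n} β k (es : Vec Entry n) → k ℕ.≤ n → Matches β k es → mismatch β k (encodeList es) ≡ 0
matches⇒mismatch β zero    es       _         _ = refl
matches⇒mismatch β (suc k) (e ∷ es) (s≤s k≤n) (empty , same) = trans (mismatch-∷ β k e es)
  (cong₂ ℕ._+_ (cong₂ ℕ._+_ (empty 0 (s≤s z≤n)) (dist-0 (same 0 (s≤s z≤n))))
    (matches⇒mismatch (λ j → β (suc j)) k es k≤n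
      ((λ j j<k → empty (suc j) (s≤s j<k)) , λ j j<k → same (suc j) (s≤s j<k))))
  where
  dist-0 : ∀ {a b} → a ≡ b → distance a b ≡ 0
  dist-0 {a} refl = cong₂ ℕ._+_ (ℕ.n∸n≡0 a) (ℕ.n∸n≡0 a)

modulus⇒converges : ∀ {y : ℕ → ℚ} {x} f → Computable f → IsModulus f y x → ConvergesComputably y x
modulus⇒converges {y} {x} f f-computable modulus =
  (λ ε 0<ε → let m , small = archimedean ε 0<ε in f m , λ n fm≤n →
     let l , u = modulus m n fm≤n in
     Equivalence.from (L-rounded x (y n - ε)) (y n - 2^- m , +-monoʳ-< (y n) (neg-antimono-< small) , l) ,
     Equivalence.from (U-rounded x (y n + ε)) (y n + 2^- m , +-monoʳ-< (y n) small , u)) ,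
  f , f-computable , modulus

module _ (em : ExcludedMiddle 0ℓ) where

  harmless-eventually : ∀ k → Eventually λ n → ∀ j → j ℕ.< k → Harmless n j
  harmless-eventually k = eventually-∀ k λ j _ → harmless j
    where
    harmless : ∀ j → Eventually λ n → Harmless n j
    harmless j with em {Total j} | em {∃ λ v → ∀ t → τ j v t ≢ 0}
    ... | yes total | _             = 0 , λ _ _ → inj₁ total
    ... | no _      | yes (v , div) = v , λ n v≤n → inj₂ λ t eq → div t (τ-antitone j t v≤n eq)
    ... | no ¬total | no conv       = ⊥-elim (¬total λ v → converges v)
      where
      converges : ∀ v → ∃ λ t → τ j v t ≡ 0
      converges v with em {∃ λ t → τ j v t ≡ 0}
      ... | yes c = c
      ... | no  d = ⊥-elim (conv (v , λ t eq → d (t , eq)))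

  -- The number of sources that station j keeps forever in all sufficiently late classes: a total φⱼ
  -- releases its source eventually, a partial one never does there.
  β : ℕ → ℕ
  β j with em {Total j}
  ... | yes _ = 0
  ... | no _  = 1

  module Increments (s : ℕ → ℕ) (s-computable : Computable s) (increasing : Increasing s) where

    abstract
      index : ∃ λ i → Total i × Bounds i (λ v → s (suc v))
      index = dominate (toComputable (app₁ s (fromComputable s-computable) (sucᶜ (var 0F))))

    i : ℕ
    i = proj₁ index

    abstract
      good : Eventually λ n → (∀ j → j ℕ.< suc i → Harmless n j) × suc i ℕ.≤ n
      good = eventually-× (harmless-eventually (suc i)) (suc i , λ _ le → le)

    n₀ : ℕ
    n₀ = proj₁ good

    module _ {n} (n₀≤n : n₀ ℕ.≤ n) where
      harmless = proj₁ (proj₂ good n n₀≤n)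
      i<n      = proj₂ (proj₂ good n n₀≤n)

      abstract
        final-state : ∃ λ T → ∀ t → T ℕ.≤ t → Empty (suc i) (stationsAt n t) ×
                      (∀ j → j ℕ.< suc i → Total j → sources (at j (stationsAt n t)) ≡ 0)
        final-state = drained n em (suc i) harmless

      -- Either φ_j is total and its source is gone from T on, or the source
      -- is never released.
      sources-frozen : ∀ {j T} → j ℕ.< suc i → sources (at j (stationsAt n T)) ≡ β j →
                       ∀ t → T ℕ.≤ t → sources (at j (stationsAt n t)) ≡ sources (at j (stationsAt n T))
      sources-frozen {j} {T} j≤i eq t T≤t with em {Total j} | harmless j j≤i
      ... | yes _ | _ = trans (ℕ.n≤0⇒n≡0 (ℕ.≤-trans (sources-antitone n j T≤t) (ℕ.≤-reflexive eq))) (sym eq)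
      ... | no ¬total | inj₁ total = ⊥-elim (¬total total)
      ... | no _ | inj₂ never = trans (sources-initial n j t λ t _ → never t) (sym (sources-initial n j T λ t _ → never t))

      matches-eventually : Eventually λ t → Matches β (suc i) (stationsAt n t)
      matches-eventually = proj₁ final-state , λ t T≤t → proj₁ (proj₂ final-state t T≤t) , released t T≤t
        where
        released : ∀ t → proj₁ final-state ℕ.≤ t → ∀ j → j ℕ.< suc i → sources (at j (stationsAt n t)) ≡ β j
        released t T≤t j j≤i with em {Total j} | harmless j j≤i
        ... | yes total | _ = proj₂ (proj₂ final-state t T≤t) j j≤i total
        ... | no ¬total | inj₁ total = ⊥-elim (¬total total)
        ... | no _ | inj₂ never = trans (sources-initial n j t λ t _ → never t) (S-0 n (ℕ.≤-trans j≤i i<n))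

    -- A zero at T certifies the hypotheses of `Window`. For n < n₀, where `suc n ∸ n₀` vanishes,
    -- the value is 0 by default, so the search for T is total.
    unready : ℕ → ℕ → ℕ → ℕ
    unready T n M = ite (suc n ∸ n₀)
      ((M ∸ T) ℕ.+ τ i n T ℕ.+ mismatch β (suc i) (encodeList (stationsAt n T))) 0

    unreadyᶜ : Recursive₃ unready
    unreadyᶜ = iteᶜ (sucᶜ (var 1F) ∸ᶜ constᶜ n₀)
      (var 2F ∸ᶜ var 0F +ᶜ τᶜ (constᶜ i) (var 1F) (var 0F) +ᶜ mismatchᶜ β (suc i) (stationsᶜ (var 1F) (var 0F))) zeroᶜ

    ready-eventually : ∀ n M → ∃ λ T → unready T n M ≡ 0
    ready-eventually n M with suc n ∸ n₀ in eq
    ... | zero  = 0 , refl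
    ... | suc _ = T , cong₂ ℕ._+_ (cong₂ ℕ._+_ (ℕ.m≤n⇒m∸n≡0 M≤T) (τ-mono i n (proj₂ conv) conv≤T))
                        (matches⇒mismatch β (suc i) (stationsAt n T) (i<n n₀≤n) (proj₂ ev T ev≤T))
      where
      n₀≤n : n₀ ℕ.≤ n
      n₀≤n = ℕ.s≤s⁻¹ (ℕ.m∸n≢0⇒n<m λ e → contradiction (trans (sym eq) e) λ ())
      ev = matches-eventually n₀≤n
      conv = proj₁ (proj₂ index) n
      T = M ℕ.+ proj₁ conv ℕ.+ proj₁ ev
      M≤T = ℕ.≤-trans (ℕ.m≤m+n M (proj₁ conv)) (ℕ.m≤m+n _ (proj₁ ev))
      conv≤T = ℕ.≤-trans (ℕ.m≤n+m (proj₁ conv) M) (ℕ.m≤m+n _ (proj₁ ev))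
      ev≤T = ℕ.m≤n+m (proj₁ ev) (M ℕ.+ proj₁ conv)

    abstract
      search : ∃ λ (f : Vec ℕ 2 → ℕ) → Recursive f ×
               (∀ xs → unready (f xs) (lookup xs 0F) (lookup xs 1F) ≡ 0)
      search = minimise {p = λ xs → unready (lookup xs 0F) (lookup xs 1F) (lookup xs 2F)}
                 unreadyᶜ λ xs → ready-eventually (lookup xs 0F) (lookup xs 1F)

    threshold : ℕ → ℕ → ℕ
    threshold n M = proj₁ search (n ∷ M ∷ [])

    thresholdᶜ : Recursive₂ threshold
    thresholdᶜ = ext (λ { (_ ∷ _ ∷ []) → refl }) (proj₁ (proj₂ search))

    class-window : ∀ {n} M k → n₀ ℕ.≤ n → threshold n M ℕ.≤ s k →
                   paid n (s (suc k)) ≤ paid n (s k) + (2^- M + 2^- M)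
    class-window {n} M k n₀≤n T≤sk = Window.window n {M = M} increasing (proj₂ (proj₂ index))
      (ℕ.m∸n≡0⇒m≤n (ℕ.m+n≡0⇒m≡0 (M ∸ T) (ℕ.m+n≡0⇒m≡0 _ ready)))
      (ℕ.m+n≡0⇒n≡0 (M ∸ T) (ℕ.m+n≡0⇒m≡0 _ ready))
      (proj₁ matches)
      (λ j j<i → sources-frozen n₀≤n (ℕ.m<n⇒m<1+n j<i) (proj₂ matches j (ℕ.m<n⇒m<1+n j<i)))
      k T≤sk
      where
      T = threshold n M
      ready : (M ∸ T) ℕ.+ τ i n T ℕ.+ mismatch β (suc i) (encodeList (stationsAt n T)) ≡ 0
      ready with suc n ∸ n₀ in eq | proj₂ (proj₂ search) (n ∷ M ∷ [])
      ... | zero  | _ = ⊥-elim (ℕ.<⇒≱ (s≤s n₀≤n) (ℕ.m∸n≡0⇒m≤n eq))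
      ... | suc _ | r = r
      matches : Matches β (suc i) (stationsAt n T)
      matches = mismatch⇒matches β (suc i) (stationsAt n T) (i<n n₀≤n)
                  (ℕ.m+n≡0⇒n≡0 ((M ∸ T) ℕ.+ τ i n T) ready)

    abstract
      T₀ : ℕ
      T₀ = proj₁ (settled-below em n₀)

      settled-early : ∀ {n t t′} → n ℕ.< n₀ → T₀ ℕ.≤ t → t ℕ.≤ t′ → paid n t′ ≤ paid n t
      settled-early {n} {t} {t′} n<n₀ T₀≤t t≤t′ = proj₂ (settled-below em n₀) t T₀≤t n n<n₀ t′ t≤t′

    -- `T₀` settles the finitely many classes below n₀, 4 + m is the number of classes that
    -- `approx-close` inspects, and the sum exceeds all their thresholds. The extra `suc` in the
    -- precision pays for the factor 2 in `class-window`.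
    modulus : ℕ → ℕ
    modulus m = T₀ ℕ.+ ((4 ℕ.+ m) ℕ.+ sumTo (λ n → threshold n (suc (n ℕ.+ (3 ℕ.+ m)))) (4 ℕ.+ m))

    modulus-computable : Computable modulus
    modulus-computable = toComputable (constᶜ T₀ +ᶜ (constᶜ 4 +ᶜ var 0F +ᶜ
      rec zeroᶜ (var 1F +ᶜ app₂ threshold thresholdᶜ (var 0F) (sucᶜ (var 0F +ᶜ (constᶜ 3 +ᶜ var 2F))))
          (constᶜ 4 +ᶜ var 0F)))

    increment-small : ∀ m k → modulus m ℕ.≤ k → approx (s (suc k)) ≤ approx (s k) + 2^- suc m
    increment-small m k le = approx-close m {s k} {s (suc k)} K≤ a≤b close
      where
      K = 4 ℕ.+ m
      Σthr = sumTo (λ n → threshold n (suc (n ℕ.+ (3 ℕ.+ m)))) K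
      a≤b = ℕ.<⇒≤ (increasing (ℕ.n<1+n k))
      -- The modulus bounds the index k, whereas the estimates concern the stage s(k) ≥ k.
      le′ = ℕ.≤-trans le (inflationary increasing k)
      K≤ : K ℕ.≤ s k
      K≤ = ℕ.≤-trans (ℕ.m≤m+n K Σthr) (ℕ.≤-trans (ℕ.m≤n+m (K ℕ.+ Σthr) T₀) le′)
      close : ∀ n → n ℕ.< K → paid n (s (suc k)) ≤ paid n (s k) + 2^- (n ℕ.+ (3 ℕ.+ m))
      close n n<K with n₀ ℕ.≤? n
      ... | no  n₀≰n = ≤-trans (settled-early (ℕ.≰⇒> n₀≰n) (ℕ.≤-trans (ℕ.m≤m+n T₀ (K ℕ.+ Σthr)) le′) a≤b)
                               (p≤p+q (2^-nonneg (n ℕ.+ (3 ℕ.+ m))))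
      ... | yes n₀≤n = ≤-trans (class-window (suc (n ℕ.+ (3 ℕ.+ m))) k n₀≤n
            (ℕ.≤-trans (≤-sumTo (λ n → threshold n (suc (n ℕ.+ (3 ℕ.+ m)))) n<K)
              (ℕ.≤-trans (ℕ.m≤n+m Σthr K) (ℕ.≤-trans (ℕ.m≤n+m (K ℕ.+ Σthr) T₀) le′))))
            (≤-reflexive (cong (_+_ (paid n (s k))) (2^-half (n ℕ.+ (3 ℕ.+ m)))))

    increments-converge : ConvergesComputably (λ k → approx (s (suc k)) - approx (s k)) (fromℚ 0ℚ)
    increments-converge = modulus⇒converges {λ k → approx (s (suc k)) - approx (s k)} {fromℚ 0ℚ} modulus modulus-computable λ m k le →
      -- The increment is at most 2^-(m+1), half of what is allowed, so the inequality of the cut is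
      -- strict.
      ≤-<-trans (+-monoˡ-≤ (- 2^- m) (small m k le)) (minus-neg m) ,
      ≤-<-trans (nonneg k) (p<p+q _ (2^-pos m))
      where
      open +-*-Solver
      nonneg : ∀ k → 0ℚ ≤ approx (s (suc k)) - approx (s k)
      nonneg k = ≤-trans (≤-reflexive (sym (+-inverseʳ (approx (s k)))))
        (+-monoˡ-≤ (- approx (s k)) (approx-mono (ℕ.<⇒≤ (increasing (ℕ.n<1+n k)))))
      small : ∀ m k → modulus m ℕ.≤ k → approx (s (suc k)) - approx (s k) ≤ 2^- suc m
      small m k le = ≤-trans (+-monoˡ-≤ (- approx (s k)) (increment-small m k le))
        (≤-reflexive (solve 2 (λ p q → p :+ q :+ :- p := q) refl (approx (s k)) (2^- suc m)))
      minus-neg : ∀ m → 2^- suc m - 2^- m < 0ℚ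
      minus-neg m = subst (2^- suc m - 2^- m <_) (+-inverseʳ (2^- m)) (+-monoˡ-< (- 2^- m)
        (subst (2^- suc m <_) (2^-half m) (p<p+q (2^- suc m) (2^-pos (suc m)))))

  limit-nearlyComputable : NearlyComputable (limit em)
  limit-nearlyComputable = approx , approx-computable , approx⟶limit em ,
    λ s s-computable increasing → Increments.increments-converge s s-computable increasing

-- Failure of regaining approximability

module _ (em : ExcludedMiddle 0ℓ) where

  module Outpaced (r : ℕ → ℕ) (r-computable : Computable r) where

    -- The sum dominates r at all arguments up to 2n, in particular at n + e for e ≤ n, although e
    -- is only obtained afterwards as an index bounding `f`.
    f : ℕ → ℕ
    f n = sumTo r (suc (n ℕ.+ n))

    abstract
      index : ∃ λ e → Total e × Bounds e f
      index = dominate (toComputable (rec zeroᶜ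
        (var 1F +ᶜ app₁ r (fromComputable r-computable) (var 0F)) (sucᶜ (var 0F +ᶜ var 0F))))

    e : ℕ
    e = proj₁ index

    abstract
      good : Eventually λ n → ∀ j → j ℕ.< suc e → Harmless n j
      good = harmless-eventually em (suc e)

    n₀ : ℕ
    n₀ = proj₁ good

    module _ (N : ℕ) (large : suc (e ℕ.+ n₀) ℕ.+ e ℕ.≤ N) where

      n a : ℕ
      -- In this class the source of e is worth 2^-(n+e) = 2^-N; `large` gives both e < n and n₀ ≤
      -- n.
      n = N ∸ e
      a = r N

      n>e+n₀ : e ℕ.+ n₀ ℕ.< n
      n>e+n₀ = ℕ.m+n≤o⇒m≤o∸n (suc (e ℕ.+ n₀)) large

      e<n : e ℕ.< n
      e<n = ℕ.≤-<-trans (ℕ.m≤m+n e n₀) n>e+n₀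

      n+e≡N : n ℕ.+ e ≡ N
      n+e≡N = ℕ.m∸n+n≡m (ℕ.≤-trans (ℕ.m≤n+m e _) large)

      abstract
        final-state : ∃ λ T → ∀ t → T ℕ.≤ t → Empty (suc e) (stationsAt n t) ×
                      (∀ j → j ℕ.< suc e → Total j → Entry.sources (at j (stationsAt n t)) ≡ 0)
        final-state = drained n em (suc e)
          (proj₂ good n (ℕ.≤-trans (ℕ.m≤n+m n₀ e) (ℕ.<⇒≤ n>e+n₀)))

      early : ∀ t → τ e n t ≡ 0 → a ℕ.≤ t
      early t eq = ℕ.≤-trans
        (≤-sumTo r (s≤s (ℕ.≤-trans (ℕ.≤-reflexive (sym n+e≡N)) (ℕ.+-monoʳ-≤ n (ℕ.<⇒≤ e<n)))))
        (proj₂ (proj₂ index) n t eq)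

      t : ℕ
      -- Late enough for class n to be drained, not before a, and greater than n so that `approx t`
      -- counts class n.
      t = proj₁ final-state ℕ.+ a ℕ.+ suc n

      a≤t : a ℕ.≤ t
      a≤t = ℕ.≤-trans (ℕ.m≤n+m a (proj₁ final-state)) (ℕ.m≤m+n _ (suc n))

      paid-later : paid n a + 2^- N ≤ paid n t
      paid-later = subst (λ m → paid n a + 2^- m ≤ paid n t) n+e≡N
        (payment n {e} {a} {proj₁ final-state} e<n early
          (λ t T≤t → proj₁ (proj₂ final-state t T≤t) ,
                     proj₂ (proj₂ final-state t T≤t) e ℕ.≤-refl (proj₁ (proj₂ index)))
          t (ℕ.≤-trans (ℕ.m≤m+n _ a) (ℕ.m≤m+n _ (suc n))) a≤t)

      gap : approx a + 2^- N ≤ approx t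
      gap = ≤-trans (+-monoˡ-≤ (2^- N) (Σpaid-monoˡ {a} {t} a a≤t))
        (Σpaid-gain {n} {a} {t} {2^- N} t (ℕ.m≤n+m (suc n) _) a≤t paid-later)

  outpaced : ∀ r → Computable r → Eventually λ N → ∃ λ t → approx (r N) + 2^- N ≤ approx t
  outpaced r r-computable =
    suc (e ℕ.+ n₀) ℕ.+ e , λ N large → t N large , gap N large
    where open Outpaced r r-computable

  module Overtake (q : ℕ → ℚ) (q-computable : Computableℚ q) (q-mono : NonDecreasing q)
                  (q⟶limit : q ⟶ limit em) where

    a b c : ℕ → ℕ
    a = proj₁ q-computable
    b = proj₁ (proj₂ q-computable)
    c = proj₁ (proj₂ (proj₂ q-computable))
    aᶜ = fromComputable (proj₁ (proj₂ (proj₂ (proj₂ q-computable))))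
    bᶜ = fromComputable (proj₁ (proj₂ (proj₂ (proj₂ (proj₂ q-computable)))))
    cᶜ = fromComputable (proj₁ (proj₂ (proj₂ (proj₂ (proj₂ (proj₂ q-computable))))))
    q≡ = proj₂ (proj₂ (proj₂ (proj₂ (proj₂ (proj₂ q-computable)))))

    -- By monotonicity q(N) may be replaced by a later term within 2^-N of the limit; the lower cut
    -- then provides an approximation.
    ahead : ∀ N → ∃ λ t → q N < approx t + 2^- N
    ahead N =
      let N₁ , close = q⟶limit (2^- N) (2^-pos N)
          (t , lt) , _ = close (N₁ ℕ.+ N) (ℕ.m≤m+n N₁ N)
      in t , ≤-<-trans (q-mono (ℕ.m≤n+m N N₁)) (subst (_< approx t + 2^- N) (cancel (q (N₁ ℕ.+ N)) (2^- N)) (+-monoˡ-< (2^- N) lt))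
      where
      cancel : ∀ p w → p - w + w ≡ p
      cancel = solve 2 (λ p w → p :+ :- w :+ w := p) refl where open +-*-Solver

    precision numerator : ℕ → ℕ → ℕ
    precision t N = denΣ t t ℕ.+ N
    numerator t N = numΣ t t ℕ.* 2 ^ N ℕ.+ 1 ℕ.* 2 ^ denΣ t t

    as-fraction : ∀ t N → approx t + 2^- N ≡ numerator t N · 2^- precision t N
    as-fraction t N = trans (cong (_+_ (approx t)) (sym (+-identityʳ (2^- N)))) (add-dyadic (numΣ t t) (denΣ t t) 1 N)

    -- The right-hand side of `⊖/-<` as a truncated difference, so that minimisation can search for
    -- the stage.
    behind : ℕ → ℕ → ℕ
    behind t N = suc (a N ℕ.* 2 ^ precision t N) ∸ (numerator t N ℕ.* suc (c N) ℕ.+ b N ℕ.* 2 ^ precision t N)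

    behindᶜ : Recursive₂ behind
    behindᶜ = sucᶜ (app₁ a aᶜ N *ᶜ 2^ᶜ ex) ∸ᶜ
              ((numΣᶜ t t *ᶜ 2^ᶜ N +ᶜ constᶜ 1 *ᶜ 2^ᶜ (denΣᶜ t t)) *ᶜ sucᶜ (app₁ c cᶜ N) +ᶜ app₁ b bᶜ N *ᶜ 2^ᶜ ex)
      where
      t = var 0F
      N = var 1F
      ex = denΣᶜ t t +ᶜ N

    fraction-< : ∀ t N → (q N < approx t + 2^- N) ⇔
                 (a N ℕ.* 2 ^ precision t N ℕ.< numerator t N ℕ.* suc (c N) ℕ.+ b N ℕ.* 2 ^ precision t N)
    fraction-< t N = subst₂ (λ p p′ → (p < p′) ⇔ (a N ℕ.* 2 ^ precision t N ℕ.<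
                                numerator t N ℕ.* suc (c N) ℕ.+ b N ℕ.* 2 ^ precision t N)) (sym (q≡ N)) (sym (as-fraction t N))
      (⊖/-< (a N) (b N) (c N) (numerator t N) (precision t N))

    behind-0 : ∀ t N → behind t N ≡ 0 → q N < approx t + 2^- N
    behind-0 t N eq = Equivalence.from (fraction-< t N) (ℕ.m∸n≡0⇒m≤n eq)

    caught-up : ∀ N → ∃ λ t → behind t N ≡ 0
    caught-up N = let t , lt = ahead N in t , ℕ.m≤n⇒m∸n≡0 (Equivalence.to (fraction-< t N) lt)

    abstract
      search : ∃ λ (f : Vec ℕ 1 → ℕ) → Recursive f × (∀ xs → behind (f xs) (lookup xs 0F) ≡ 0)
      search = minimise {p = λ xs → behind (lookup xs 0F) (lookup xs 1F)} behindᶜ λ xs → caught-up (lookup xs 0F)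

    stage : ℕ → ℕ
    stage N = proj₁ search (suc N ∷ [])

    stage-computable : Computable stage
    stage-computable = toComputable
      (app₁ (λ N → proj₁ search (N ∷ [])) (ext (λ { (_ ∷ []) → refl }) (proj₁ (proj₂ search))) (sucᶜ (var 0F)))

    q<approx : ∀ N → q (suc N) < approx (stage N) + 2^- suc N
    q<approx N = behind-0 (stage N) (suc N) (proj₂ (proj₂ search) (suc N ∷ []))

    abstract
      gap : Eventually λ N → ∃ λ t → approx (stage N) + 2^- N ≤ approx t
      gap = outpaced stage stage-computable

    -- The shift from N to N + 1 leaves room for two errors: q lies less than 2^-(N+1) above the
    -- approximation at `stage N`, and x would lie less than 2^-(N+1) above q. Together they stay
    -- below the jump 2^-N.
    too-close : ∀ N → proj₁ gap ℕ.≤ N → ¬ (limit em ⊝ q (suc N) < (2^- suc N))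
    too-close N large (r , r<q+ , bound) = <-irrefl refl (begin-strict
      approx t                                     ≤⟨ bound t ⟩
      r                                            <⟨ r<q+ ⟩
      q (suc N) + 2^- suc N                        <⟨ +-monoˡ-< (2^- suc N) (q<approx N) ⟩
      approx (stage N) + 2^- suc N + 2^- suc N     ≡⟨ +-assoc (approx (stage N)) _ _ ⟩
      approx (stage N) + (2^- suc N + 2^- suc N)   ≡⟨ cong (_+_ (approx (stage N))) (2^-half N) ⟩
      approx (stage N) + 2^- N                     ≤⟨ proj₂ (proj₂ gap N large) ⟩
      approx t                                     ∎)
      where
      open ≤-Reasoning
      t = proj₁ (proj₂ gap N large)

  limit-notRegaining : ¬ RegaininglyApproximable (limit em)
  limit-notRegaining (q , q-computable , q-mono , q⟶limit , often) = go (often (suc (proj₁ gap)))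
    where
    open Overtake q q-computable q-mono q⟶limit
    go : (∃ λ n → suc (proj₁ gap) ℕ.≤ n × (limit em ⊝ q n < (2^- n))) → ⊥
    -- Asking for an index beyond `suc (proj₁ gap)` makes it a successor whose predecessor is still
    -- in the range of `gap`.
    go (suc N , s≤s large , close) = too-close N large close

theorem3p2 : ExcludedMiddle 0ℓ →
    ∃ λ (x : ℝ) → LeftComputable x × NearlyComputable x × ¬ RegaininglyApproximable x
theorem3p2 em = limit em , limit-leftComputable em , limit-nearlyComputable em , limit-notRegaining em
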